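{- Let $\phi(n)$ and $\psi(n)$ be growing functions (which may grow arbitrarily slowly) such that $\phi(n) \leq n/(\log_2 n + \log_2 \psi(n))$. If $q_0 = q_0(n) \sim n\,2^{\,n-\lceil n/\phi(n)\rceil}$ as $n\to\infty$, then $$W(n,q_0) \lesssim W^{(C)}\cdot 2^n + W^{(T)}\cdot n\,2^{\,n-\lceil n/\phi(n)\rceil}.$$
   Context: Let $\mathbb B=\{0,1\}$. For a set $I=\{i_1,\dots,i_k\}\subseteq\{1,\dots,m\}$ and $t\in\{1,\dots,m\}\setminus I$, the generalized Toffoli gate $TOF(I;t)$ on $m$ lines is the gate defining the map $\mathbb B^m\to\mathbb B^m$ which replaces $x_t$ by $x_t\oplus (x_{i_1}\wedge\cdots\wedge x_{i_k})$ and leaves the other coordinates unchanged (for $k=0$, it is the NOT gate $x_t\mapsto x_t\oplus 1$). $\Omega_m^2$ is the set of all such gates on $m$ lines with $k\le 2$, i.e. all NOT ($k=0$), CNOT ($k=1$) and C$^2$NOT ($k=2$) gates. A reversible circuit $\mathfrak S$ with $m$ inputs is a finite sequence (composition) of gates from $\Omega_m^2$, all acting on the same $m$ numbered lines. Every NOT and every CNOT gate has the same weight $W^{(C)}>0$ and every C$^2$NOT gate has weight $W^{(T)}>0$ (numbers determined by the underlying technology). The quantum weight $W(\mathfrak S)$ of a circuit is the sum of the weights of all its gates. A circuit with $n+q$ inputs implements $f\colon\mathbb B^n\to\mathbb B^r$ with $q$ additional inputs if there is a permutation $\pi$ of the $n+q$ output lines such that for every $x\in\mathbb B^n$ the input $\langle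 x_1,\dots,x_n,0,\dots,0\rangle$ is transformed by the circuit, after applying $\pi$ to the outputs, into $\langle y_1,\dots,y_r,*,\dots,*\rangle$ with $f(\langle x_1,\dots,x_n\rangle)=\langle y_1,\dots,y_r\rangle$; the outputs marked $*$ are arbitrary (computational garbage is allowed). $F(n,q)$ is the set of all transformations $\mathbb B^n\to\mathbb B^n$ that can be implemented by reversible circuits with $n+q$ inputs (gates from $\Omega_{n+q}^2$). For $f\in F(n,q)$, $W(f,q)$ is the minimum of $W(\mathfrak S)$ over all reversible circuits $\mathfrak S$ implementing $f$ with $q$ additional inputs, and $W(n,q)=\max_{f\in F(n,q)}W(f,q)$. Asymptotics are for $n\to\infty$: $a(n)\sim b(n)$ means $a(n)/b(n)\to1$; $a(n)\lesssim b(n)$ means $\limsup a(n)/b(n)\le 1$. A growing function is one tending to infinity; inequalities between functions of $n$ are required for all sufficiently large $n$. -}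

module Defs where

open import Level using (Level; _⊔_; suc)
open import Algebra.Bundles using (CommutativeRing)
import Algebra.Definitions.RawMonoid as RawMonoidDefs
open import Data.Bool.Base using (Bool; true; false; not; _∧_; _∨_; _xor_; if_then_else_)
open import Data.Fin.Base using (Fin)
open import Data.Fin.Permutation using (Permutation′; _⟨$⟩ʳ_)
open import Data.Fin.Subset using (Subset; _∉_; ∣_∣)
open import Data.List.Base using (List; []; _∷_; foldr; foldl)
import Data.Nat.Base as ℕ
open import Data.Nat.Base using (ℕ)
open import Data.Product.Base using (Σ-syntax; ∃-syntax; _×_)
open import Data.Vec.Base as Vec using (Vec; _++_; replicate; zipWith; lookup; tabulate; updateAt)
open import Relation.Binary.Core using (Rel)
open import Relation.Binary.Definitions using (Antisymmetric; Cotransitive)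
open import Relation.Binary.PropositionalEquality.Core using (_≡_)
open import Relation.Binary.Structures using (IsStrictPartialOrder)
open import Relation.Nullary.Negation.Core using (¬_)

-- The real numbers, axiomatised as a Cauchy-complete Archimedean ordered
-- field.  Classically these axioms determine ℝ up to a unique isomorphism.
-- Trichotomy is replaced by cotransitivity of _<_ and antisymmetry of _≤_
-- so that constructive constructions of ℝ are models as well.
record RealNumbers (c ℓ₁ ℓ₂ : Level) : Set (suc (c ⊔ ℓ₁ ⊔ ℓ₂)) where
  field
    commutativeRing : CommutativeRing c ℓ₁

  open CommutativeRing commutativeRing public

  infix 4 _<_ _≤_

  field
    _<_                  : Rel Carrier ℓ₂
    isStrictPartialOrder : IsStrictPartialOrder _≈_ _<_

  _≤_ : Rel Carrier ℓ₂
  x ≤ y = ¬ (y < x)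

  -- ι n is the natural number n regarded as a real.
  open RawMonoidDefs +-rawMonoid using () renaming (_×_ to _·_)

  ι : ℕ → Carrier
  ι n = n · 1#

  -- Within ε x y is |x − y| < ε.
  Within : Carrier → Carrier → Carrier → Set ℓ₂
  Within ε x y = (x - y < ε) × (y - x < ε)

  field
    <-cotrans   : Cotransitive _<_
    ≤-antisym   : Antisymmetric _≈_ _≤_
    0<1         : 0# < 1#
    +-monoʳ-<   : ∀ x {y z} → y < z → x + y < x + z
    *-pos       : ∀ {x y} → 0# < x → 0# < y → 0# < x * y
    recip       : ∀ x → 0# < x → Carrier
    *-recip     : ∀ x (0<x : 0# < x) → x * recip x 0<x ≈ 1#
    archimedean : ∀ x → ∃[ n ] x < ι n
    complete    : (u : ℕ → Carrier) →
                  (∀ ε → 0# < ε → ∃[ N ] ∀ m n → N ℕ.≤ m → N ℕ.≤ n → Within ε (u m) (u n)) →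
                  ∃[ l ] ∀ ε → 0# < ε → ∃[ N ] ∀ n → N ℕ.≤ n → Within ε (u n) l

  infixl 7 _/_⟨_⟩

  _/_⟨_⟩ : Carrier → (y : Carrier) → 0# < y → Carrier
  x / y ⟨ 0<y ⟩ = x * recip y 0<y

  IsCeiling : Carrier → ℕ → Set ℓ₂
  IsCeiling x k = (x ≤ ι k) × (ι k < x + 1#)

module Logarithm {c ℓ₁ ℓ₂} (ℝ : RealNumbers c ℓ₁ ℓ₂) where
  open RealNumbers ℝ

  -- The axioms determine log₂ uniquely on the positive reals.
  record IsLog₂ (log₂ : ∀ x → 0# < x → Carrier) : Set (c ⊔ ℓ₁ ⊔ ℓ₂) where
    field
      log₂-cong   : ∀ {x y} 0<x 0<y → x ≈ y → log₂ x 0<x ≈ log₂ y 0<y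
      log₂-mono-< : ∀ {x y} 0<x 0<y → x < y → log₂ x 0<x < log₂ y 0<y
      log₂-*      : ∀ {x y} 0<x 0<y 0<xy →
                    log₂ (x * y) 0<xy ≈ log₂ x 0<x + log₂ y 0<y
      log₂-2      : ∀ 0<2 → log₂ (ι 2) 0<2 ≈ 1#

Eventually : ∀ {p} → (ℕ → Set p) → Set p
Eventually P = ∃[ N ] ∀ n → N ℕ.≤ n → P n

module Asymptotics {c ℓ₁ ℓ₂} (ℝ : RealNumbers c ℓ₁ ℓ₂) where
  open RealNumbers ℝ

  Growing : (ℕ → Carrier) → Set (c ⊔ ℓ₂)
  Growing a = ∀ M → Eventually λ n → M < a n

  infix 4 _∼_ _≲_

  -- In both relations the sequence b is required to be eventually positive,
  -- which makes the quotient a(n)/b(n) meaningful.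
  _∼_ : Rel (ℕ → Carrier) (c ⊔ ℓ₂)
  a ∼ b = ∀ ε → 0# < ε → Eventually λ n →
          Σ[ 0<bn ∈ 0# < b n ] Within ε (a n / b n ⟨ 0<bn ⟩) 1#

  -- limsup a(n)/b(n) ≤ 1.
  _≲_ : Rel (ℕ → Carrier) (c ⊔ ℓ₂)
  a ≲ b = ∀ ε → 0# < ε → Eventually λ n →
          Σ[ 0<bn ∈ 0# < b n ] a n / b n ⟨ 0<bn ⟩ < 1# + ε

-- The gate TOF(I;t) on m lines with I = controls, t = target and |I| ≤ 2.
record Gate (m : ℕ) : Set where
  constructor TOF
  field
    controls          : Subset m
    target            : Fin m
    target∉controls   : target ∉ controls
    ∣controls∣≤2      : ∣ controls ∣ ℕ.≤ 2

open Gate public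

-- Conjunction of the coordinates of x selected by I; it is true for empty I.
⋀ : ∀ {m} → Subset m → Vec Bool m → Bool
⋀ I x = Vec.foldr′ _∧_ true (zipWith (λ i∈I xᵢ → not i∈I ∨ xᵢ) I x)

applyGate : ∀ {m} → Vec Bool m → Gate m → Vec Bool m
applyGate x g = updateAt x (target g) (_xor ⋀ (controls g) x)

Circuit : ℕ → Set
Circuit m = List (Gate m)

-- The head of the list is the first gate to act.
run : ∀ {m} → Circuit m → Vec Bool m → Vec Bool m
run 𝔖 x = foldl applyGate x 𝔖

permute : ∀ {m} → Permutation′ m → Vec Bool m → Vec Bool m
permute π y = tabulate λ i → lookup y (π ⟨$⟩ʳ i)

Implements : ∀ {n} q → Circuit (n ℕ.+ q) → (Vec Bool n → Vec Bool n) → Set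
Implements {n} q 𝔖 f =
  ∃[ π ] ∀ x → Σ[ garbage ∈ Vec Bool q ]
    permute π (run 𝔖 (x ++ replicate q false)) ≡ f x ++ garbage

F : ∀ n q → (Vec Bool n → Vec Bool n) → Set
F n q f = ∃[ 𝔖 ] Implements q 𝔖 f

module QuantumWeight {c ℓ₁ ℓ₂} (ℝ : RealNumbers c ℓ₁ ℓ₂) where
  open RealNumbers ℝ

  module _ (Wᶜ Wᵀ : Carrier) where

    gateWeight : ∀ {m} → Gate m → Carrier
    gateWeight g = if ∣ controls g ∣ ℕ.≤ᵇ 1 then Wᶜ else Wᵀ

    weight : ∀ {m} → Circuit m → Carrier
    weight = foldr (λ g w → gateWeight g + w) 0#

    -- w = W(f,q).  Minima (and maxima below) of sets of reals are given by
    -- relations, as they are not computable from the set.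
    IsMinWeight : ∀ {n} q → (Vec Bool n → Vec Bool n) → Carrier → Set (ℓ₁ ⊔ ℓ₂)
    IsMinWeight q f w =
      (∃[ 𝔖 ] Implements q 𝔖 f × weight 𝔖 ≈ w) ×
      (∀ 𝔖 → Implements q 𝔖 f → w ≤ weight 𝔖)

    -- w = W(n,q).
    IsMaxMinWeight : ∀ n q → Carrier → Set (c ⊔ ℓ₁ ⊔ ℓ₂)
    IsMaxMinWeight n q w =
      (∃[ f ] F n q f × IsMinWeight q f w) ×
      (∀ f → F n q f → ∀ v → IsMinWeight q f v → v ≤ w)

{-# OPTIONS --safe #-}
module Submission where

-- Split the n = k + l inputs into a head of k and a tail of l variables and put
-- s = n − 2k.  The 2^l monomials of the tail and the 2^k monomials of the head
-- are computed once, with one C²NOT gate each.  The head monomials are cut into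
-- p ≈ 2^k / s chunks of s, and all 2^s XOR combinations of each chunk are
-- tabulated; this is cheap because p 2^s ≈ 2^l / s.  Every coordinate of the map is
-- ⨁ᵤ gᵤ(head) ∧ u(tail) over the tail monomials u, and each gᵤ, itself an XOR of
-- head monomials, is the sum of one table entry per chunk: p CNOT gates.  So the
-- n 2^l pairs (coordinate, u) cost n 2^l p ≈ (n / s) 2^n CNOT gates and n 2^l
-- C²NOT gates.  The hypotheses on φ and ψ give k = o(n) and n = o(2^k), which
-- yields n / s → 1 and makes everything else negligible.

open import Defs
open import Data.Nat.Base using (ℕ; _∸_; _^_) renaming (_*_ to _*ℕ_)
open import Data.Product.Base using (Σ-syntax)

import Algebra.Properties.Semiring.Mult as SemiringMult
import Algebra.Solver.Ring.NaturalCoefficients.Default as CommutativeSemiringSolver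
open import Data.Bool.Base using (Bool; true; false; not; _∧_; _xor_; if_then_else_)
open import Data.Empty using (⊥-elim)
open import Data.List.Base using (List; []; _∷_)
import Data.Nat.Base as ℕ
open import Data.Nat.Base using (zero; suc; z≤n; s≤s; NonZero; >-nonZero)
  renaming (_+_ to _+ℕ_; _≤_ to _≤ℕ_; _<_ to _<ℕ_)
import Data.Nat.Properties as ℕₚ
open import Data.Nat.Solver using (module +-*-Solver)
open import Data.Product.Base using (∃-syntax; _×_; _,_; proj₁; proj₂)
open import Data.Sum.Base using (_⊎_; inj₁; inj₂; [_,_]′)
open import Data.Vec.Base as Vec using (Vec; []; _∷_; lookup)
open import Function.Base using (_∘_; id)
open import Relation.Binary.PropositionalEquality as ≡ using (_≡_; _≢_)
open import Relation.Binary.Structures using (IsStrictPartialOrder)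
open import Relation.Nullary using (¬_; yes; no)

-- Tabulating XOR combinations is the method of the four Russians: a sum of up to 2^k head monomials
-- is assembled from ready-made partial sums. A larger s makes the sums cheaper and the tables
-- bigger; s = n - 2k is the choice for which the p 2^s table lines stay within a constant multiple
-- of 2^l, and so fit into q₀ ∼ n 2^l.
--
-- The growth of 2^k / n pays for rounding: one chunk beyond 2^k / s adds up to n 2^l CNOTs over all
-- pairs, a fraction n / 2^k of 2^n. The inequality n ψ ≤ 2^k behind it is the hypothesis on φ and ψ
-- with the logarithms removed.
--
-- Every map is realised, bijective or not, since garbage may stay on the ancillas. Overwriting the
-- inputs by the outputs is safe because the rows consult only finished tables and their own
-- accumulators.
--
-- Counting happens in ℕ, where a relative error is an inequality M x ≤ (M + 1) y; the reals enter
-- only to compare 1 / M with ε.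

-- Gate and line counts, estimated in the natural numbers

module Arithmetic where
  open import Data.Nat.Base using (_+_; _*_; _≤_)
  open import Data.Nat.DivMod using (m/n*n≤m; m%n<n; m≡m%n+[m/n]*n; _/_; _%_)
  open import Data.Nat.Properties
  open import Relation.Binary.PropositionalEquality using (refl; cong; sym; trans)
  open +-*-Solver using (solve; _:=_; _:+_; _:*_; con)
  open ≤-Reasoning

  -- One more than the floor, whether or not `s` divides `a`; the excess of at most `s` in
  -- `chunks a s * s` is of lower order.
  chunks : ℕ → (s : ℕ) → .{{NonZero s}} → ℕ
  chunks a s = suc (a / s)

  chunks-lower : ∀ a s .{{_ : NonZero s}} → a ≤ chunks a s * s
  chunks-lower a s = begin
    a                     ≡⟨ m≡m%n+[m/n]*n a s ⟩
    a % s + a / s * s     ≤⟨ +-monoˡ-≤ _ (<⇒≤ (m%n<n a s)) ⟩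
    s + a / s * s         ∎

  chunks-upper : ∀ a s .{{_ : NonZero s}} → chunks a s * s ≤ s + a
  chunks-upper a s = +-monoʳ-≤ s (m/n*n≤m a s)

  -- The constant 2 counts the NOT gates that start the two monomial tables; an entry of an XOR
  -- table takes two CNOTs, hence `2 * 2 ^ s`. In `ancillas` the first `n` is one accumulator per
  -- coordinate, and the bracketing follows the sum type that names the extra lines.
  cnotBound toffoliBound ancillas : (n k l s p : ℕ) → ℕ
  cnotBound    n k l s p = 2 + (p * (2 * 2 ^ s) + n * (2 ^ l * p))
  toffoliBound n k l s p = 2 ^ l + 2 ^ k + n * 2 ^ l
  ancillas     n k l s p = n + (2 ^ l + (2 ^ k + p * 2 ^ s))

  module _ {k s : ℕ} .{{_ : NonZero s}} where
    private
      n = k + (k + s)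
      l = k + s
      a = 2 ^ k
      b = 2 ^ s
      p = chunks a s

      2^l≡ab : 2 ^ l ≡ a * b
      2^l≡ab = ^-distribˡ-+-* 2 k s

      2^n≡aab : 2 ^ n ≡ a * (a * b)
      2^n≡aab = trans (^-distribˡ-+-* 2 k l) (cong (a *_) 2^l≡ab)

      s≤n : s ≤ n
      s≤n = ≤-trans (m≤n+m s k) (m≤n+m l k)

      1≤b : 1 ≤ b
      1≤b = m^n>0 2 s

    -- `K` is chosen so that (K + 2) / (K - 2) = (M + 1) / M. The denominator comes from s = n - 2k,
    -- which is at least n (K - 2) / K. The 2 in the numerator is the share of two lower-order terms
    -- n^2 2^l, each at most n 2^n / K.
    cnotBound-asymptotic : ∀ M → let K = 4 * M + 2 in
      3 ≤ n → K * k ≤ n → n * K ≤ a →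
      M * cnotBound n k l s p ≤ suc M * 2 ^ n
    cnotBound-asymptotic M 3≤n Kk≤n nK≤a =
      -- The factor `4 * n` turns 4 M n into K s on the left, so that no division by `s` is needed.
      *-cancelˡ-≤ (4 * n) {{m*n≢0 4 n {{_}} {{>-nonZero (≤-trans (s≤s z≤n) 3≤n)}}}} (begin
        4 * n * (M * C)            ≡⟨ solve 3 (λ n M C → con 4 :* n :* (M :* C) := con 4 :* M :* n :* C) refl n M C ⟩
        4 * M * n * C              ≤⟨ *-monoˡ-≤ C 4Mn≤Ks ⟩
        K * s * C                  ≡⟨ *-assoc K s C ⟩
        K * (s * C)                ≤⟨ *-monoʳ-≤ K sC≤ ⟩
        K * (6 * (a * b) + n * n * (a * b) + n * (a * (a * b)))
                                   ≤⟨ *-monoʳ-≤ K (+-monoˡ-≤ _ (+-monoˡ-≤ _ (*-monoˡ-≤ (a * b) 6≤nn))) ⟩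
        K * (n * n * (a * b) + n * n * (a * b) + n * (a * (a * b)))
          ≡⟨ solve 4 (λ K n a b → K :* (n :* n :* (a :* b) :+ n :* n :* (a :* b) :+ n :* (a :* (a :* b)))
                               := con 2 :* n :* ((n :* K) :* (a :* b)) :+ K :* n :* (a :* (a :* b)))
               refl K n a b ⟩
        2 * n * ((n * K) * (a * b)) + K * n * (a * (a * b))
                                   ≤⟨ +-monoˡ-≤ _ (*-monoʳ-≤ (2 * n) (*-monoˡ-≤ (a * b) nK≤a)) ⟩
        2 * n * (a * (a * b)) + K * n * (a * (a * b))
          ≡⟨ solve 3 (λ M n x → con 2 :* n :* x :+ (con 4 :* M :+ con 2) :* n :* x
                               := con 4 :* n :* ((con 1 :+ M) :* x)) refl M n (a * (a * b)) ⟩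
        4 * n * (suc M * (a * (a * b))) ≡⟨ cong (λ x → 4 * n * (suc M * x)) (sym 2^n≡aab) ⟩
        4 * n * (suc M * 2 ^ n)    ∎)
      where
      K = 4 * M + 2
      C = cnotBound n k l s p

      n≤a : n ≤ a
      n≤a = begin
        n      ≤⟨ m≤m*n n K {{>-nonZero (≤-trans (s≤s z≤n) (m≤n+m 2 (4 * M)))}} ⟩
        n * K  ≤⟨ nK≤a ⟩
        a      ∎

      6≤nn : 6 ≤ n * n
      6≤nn = ≤-trans (m≤m+n 6 3) (*-mono-≤ 3≤n 3≤n)

      4Mn≤Ks : 4 * M * n ≤ K * s
      4Mn≤Ks = +-cancelˡ-≤ (2 * n) _ _ (begin
        2 * n + 4 * M * n        ≡⟨ solve 2 (λ M n → con 2 :* n :+ con 4 :* M :* n := (con 4 :* M :+ con 2) :* n) refl M n ⟩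
        K * n                    ≡⟨ solve 3 (λ K k s → K :* (k :+ (k :+ s)) := con 2 :* (K :* k) :+ K :* s) refl K k s ⟩
        2 * (K * k) + K * s      ≤⟨ +-monoˡ-≤ (K * s) (*-monoʳ-≤ 2 Kk≤n) ⟩
        2 * n + K * s            ∎)

      -- `chunks-upper` replaces p s by s + a. The part with `a` gives the main term, the part with
      -- `s` is the price of the incomplete chunk.
      sC≤ : s * C ≤ 6 * (a * b) + n * n * (a * b) + n * (a * (a * b))
      sC≤ = begin
        s * (2 + (p * (2 * b) + n * (2 ^ l * p)))
          ≡⟨ cong (λ x → s * (2 + (p * (2 * b) + n * (x * p)))) 2^l≡ab ⟩
        s * (2 + (p * (2 * b) + n * (a * b * p)))
          ≡⟨ solve 5 (λ s p n a b → s :* (con 2 :+ (p :* (con 2 :* b) :+ n :* (a :* b :* p)))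
                                 := con 2 :* (s :* con 1) :+ p :* s :* (con 2 :* b :+ n :* (a :* b))) refl s p n a b ⟩
        2 * (s * 1) + p * s * (2 * b + n * (a * b))
          ≤⟨ +-mono-≤ (*-monoʳ-≤ 2 (*-mono-≤ (≤-trans s≤n n≤a) 1≤b)) (*-monoˡ-≤ _ (chunks-upper a s)) ⟩
        2 * (a * b) + (s + a) * (2 * b + n * (a * b))
          ≡⟨ solve 5 (λ s p n a b → con 2 :* (a :* b) :+ (s :+ a) :* (con 2 :* b :+ n :* (a :* b))
                         := con 2 :* (a :* b) :+ con 2 :* (s :* b) :+ con 2 :* (a :* b)
                          :+ s :* (n :* (a :* b)) :+ n :* (a :* (a :* b))) refl s p n a b ⟩
        2 * (a * b) + 2 * (s * b) + 2 * (a * b) + s * (n * (a * b)) + n * (a * (a * b))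
          ≤⟨ +-monoˡ-≤ _ (+-mono-≤ (+-monoˡ-≤ _ (+-monoʳ-≤ (2 * (a * b)) (*-monoʳ-≤ 2 (*-monoˡ-≤ b (≤-trans s≤n n≤a)))))
                                   (*-monoˡ-≤ _ s≤n)) ⟩
        2 * (a * b) + 2 * (a * b) + 2 * (a * b) + n * (n * (a * b)) + n * (a * (a * b))
          ≡⟨ solve 3 (λ n a b → con 2 :* (a :* b) :+ con 2 :* (a :* b) :+ con 2 :* (a :* b)
                       :+ n :* (n :* (a :* b)) :+ n :* (a :* (a :* b))
                         := con 6 :* (a :* b) :+ n :* n :* (a :* b) :+ n :* (a :* (a :* b))) refl n a b ⟩
        6 * (a * b) + n * n * (a * b) + n * (a * (a * b)) ∎

    toffoliBound-asymptotic : ∀ M → 2 * M ≤ n →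
      M * toffoliBound n k l s p ≤ suc M * (n * 2 ^ l)
    toffoliBound-asymptotic M 2M≤n = begin
      M * (2 ^ l + a + n * 2 ^ l)            ≤⟨ *-monoʳ-≤ M (+-monoˡ-≤ (n * 2 ^ l) (+-monoʳ-≤ (2 ^ l) (^-monoʳ-≤ 2 (m≤m+n k s)))) ⟩
      M * (2 ^ l + 2 ^ l + n * 2 ^ l)        ≡⟨ solve 3 (λ M x n → M :* (x :+ x :+ n :* x) := con 2 :* M :* x :+ M :* (n :* x)) refl M (2 ^ l) n ⟩
      2 * M * 2 ^ l + M * (n * 2 ^ l)        ≤⟨ +-monoˡ-≤ _ (*-monoˡ-≤ (2 ^ l) 2M≤n) ⟩
      n * 2 ^ l + M * (n * 2 ^ l)            ∎

    -- Five copies of 2^l suffice: one each for the accumulators, the tail monomials and the head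
    -- monomials, and two for the XOR tables. As `q` is only known to be at least half of n 2^l,
    -- this takes n ≥ 10.
    ancillas-fit : ∀ {q} → 10 ≤ n → n ≤ a → n * 2 ^ l ≤ 2 * q → ancillas n k l s p ≤ q
    ancillas-fit {q} 10≤n n≤a h = *-cancelˡ-≤ 2 (begin
      2 * (n + (2 ^ l + (a + p * b)))
        ≤⟨ *-monoʳ-≤ 2 (+-mono-≤ (≤-trans n≤a a≤) (+-monoʳ-≤ (2 ^ l) (+-mono-≤ a≤ pb≤))) ⟩
      2 * (2 ^ l + (2 ^ l + (2 ^ l + 2 * 2 ^ l)))
        ≡⟨ solve 1 (λ x → con 2 :* (x :+ (x :+ (x :+ con 2 :* x))) := con 10 :* x) refl (2 ^ l) ⟩
      10 * 2 ^ l  ≤⟨ *-monoˡ-≤ (2 ^ l) 10≤n ⟩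
      n * 2 ^ l   ≤⟨ h ⟩
      2 * q       ∎)
      where
      a≤ : a ≤ 2 ^ l
      a≤ = ^-monoʳ-≤ 2 (m≤m+n k s)
      pb≤ : p * b ≤ 2 * 2 ^ l
      pb≤ = begin
        b + a / s * b   ≤⟨ +-mono-≤ (m≤n*m b a {{m^n≢0 2 k}})
                             (*-monoˡ-≤ b (≤-trans (m≤m*n (a / s) s) (m/n*n≤m a s))) ⟩
        a * b + a * b   ≡⟨ solve 1 (λ x → x :+ x := con 2 :* x) refl (a * b) ⟩
        2 * (a * b)     ≡⟨ cong (2 *_) (sym 2^l≡ab) ⟩
        2 * 2 ^ l       ∎

module Synthesis where
  open Arithmetic using (cnotBound; toffoliBound; ancillas)
  open import Data.Bool.Properties
    using (∧-assoc; ∧-identityʳ; ∧-zeroʳ; xor-assoc; xor-comm; xor-identityʳ; xor-same; T-≡; ¬-not)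
  open import Data.Fin.Base as Fin using (Fin; zero; suc)
  open import Data.Fin.Permutation using () renaming (id to idₚ)
  import Data.Fin.Properties as Finₚ
  open import Data.Fin.Subset as Subset using (Subset; ⁅_⁆; _∪_; ∣_∣; inside; outside)
  open import Data.Fin.Subset.Properties
    using (∣⊥∣≡0; ∣⁅x⁆∣≡1; x≢y⇒x∉⁅y⁆; x∈⁅x⁆; x∈p∪q⁻; ∉⊥; p⊆p∪q; q⊆p∪q; p⊂q⇒∣p∣<∣q∣)
  open import Data.List.Base as List using (_++_; concatMap; length; allFin)
  open import Data.List.Membership.Propositional using (_∈_)
  open import Data.List.Membership.Propositional.Properties using (∈-map⁺; ∈-++⁺ˡ; ∈-++⁺ʳ; ∈-map⁻; ∈-allFin)
  import Data.List.Properties as Listₚ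
  open import Data.List.Relation.Unary.All as All using (All; []; _∷_)
  import Data.List.Relation.Unary.All.Properties as Allₚ
  open import Data.List.Relation.Unary.Any using (here; there)
  open import Data.List.Relation.Unary.Unique.Propositional using (Unique; []; _∷_)
  import Data.List.Relation.Unary.Unique.Propositional.Properties as Uniqueₚ
  open import Data.Nat.Base using (_+_; _*_; _≤_; _<_; _≤ᵇ_)
  open import Data.Nat.ListAction using (sum)
  open import Data.Nat.ListAction.Properties using (sum-++)
  import Data.Sum.Base as Sum
  open import Data.Sum.Properties using (inj₁-injective; inj₂-injective)
  import Data.Vec.Properties as Vecₚ
  open import Function.Bundles using (Equivalence)
  open import Relation.Binary.PropositionalEquality
    using (refl; sym; trans; cong; cong₂; subst; module ≡-Reasoning)

  private
    variable
      m k l s p : ℕ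

  -- Gates with at most two controls

  ⋀-∪ : ∀ (I J : Subset m) x → ⋀ (I ∪ J) x ≡ ⋀ I x ∧ ⋀ J x
  ⋀-∪ []            []            []      = refl
  ⋀-∪ (outside ∷ I) (outside ∷ J) (b ∷ x) = ⋀-∪ I J x
  ⋀-∪ (inside ∷ I)  (outside ∷ J) (b ∷ x) = trans (cong (b ∧_) (⋀-∪ I J x)) (sym (∧-assoc b _ _))
  ⋀-∪ (outside ∷ I) (inside ∷ J)  (true ∷ x)  = ⋀-∪ I J x
  ⋀-∪ (outside ∷ I) (inside ∷ J)  (false ∷ x) = sym (∧-zeroʳ _)
  ⋀-∪ (inside ∷ I)  (inside ∷ J)  (true ∷ x)  = ⋀-∪ I J x
  ⋀-∪ (inside ∷ I)  (inside ∷ J)  (false ∷ x) = refl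

  ⋀-⊥ : (x : Vec Bool m) → ⋀ Subset.⊥ x ≡ true
  ⋀-⊥ []      = refl
  ⋀-⊥ (b ∷ x) = ⋀-⊥ x

  ⋀-⁅⁆ : ∀ (i : Fin m) x → ⋀ ⁅ i ⁆ x ≡ lookup x i
  ⋀-⁅⁆ zero    (b ∷ x) = trans (cong (b ∧_) (⋀-⊥ x)) (∧-identityʳ b)
  ⋀-⁅⁆ (suc i) (b ∷ x) = ⋀-⁅⁆ i x

  ∣p∪q∣≤∣p∣+∣q∣ : (I J : Subset m) → ∣ I ∪ J ∣ ≤ ∣ I ∣ + ∣ J ∣
  ∣p∪q∣≤∣p∣+∣q∣ []            []            = z≤n
  ∣p∪q∣≤∣p∣+∣q∣ (outside ∷ I) (outside ∷ J) = ∣p∪q∣≤∣p∣+∣q∣ I J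
  ∣p∪q∣≤∣p∣+∣q∣ (outside ∷ I) (inside ∷ J)  =
    ℕₚ.≤-trans (s≤s (∣p∪q∣≤∣p∣+∣q∣ I J)) (ℕₚ.≤-reflexive (sym (ℕₚ.+-suc ∣ I ∣ ∣ J ∣)))
  ∣p∪q∣≤∣p∣+∣q∣ (inside ∷ I)  (outside ∷ J) = s≤s (∣p∪q∣≤∣p∣+∣q∣ I J)
  ∣p∪q∣≤∣p∣+∣q∣ (inside ∷ I)  (inside ∷ J)  =
    s≤s (ℕₚ.≤-trans (∣p∪q∣≤∣p∣+∣q∣ I J) (ℕₚ.+-monoʳ-≤ ∣ I ∣ (ℕₚ.n≤1+n ∣ J ∣)))

  NOT : Fin m → Gate m
  NOT {m} t = TOF Subset.⊥ t ∉⊥ (ℕₚ.≤-trans (ℕₚ.≤-reflexive (∣⊥∣≡0 m)) z≤n)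

  CNOT : (c t : Fin m) → c ≢ t → Gate m
  CNOT c t c≢t = TOF ⁅ c ⁆ t (x≢y⇒x∉⁅y⁆ (c≢t ∘ sym)) (ℕₚ.≤-trans (ℕₚ.≤-reflexive (∣⁅x⁆∣≡1 c)) (s≤s z≤n))

  C²NOT : (c d t : Fin m) → c ≢ t → d ≢ t → Gate m
  C²NOT c d t c≢t d≢t = TOF (⁅ c ⁆ ∪ ⁅ d ⁆) t
    ([ x≢y⇒x∉⁅y⁆ (c≢t ∘ sym) , x≢y⇒x∉⁅y⁆ (d≢t ∘ sym) ]′ ∘ x∈p∪q⁻ ⁅ c ⁆ ⁅ d ⁆)
    (ℕₚ.≤-trans (∣p∪q∣≤∣p∣+∣q∣ ⁅ c ⁆ ⁅ d ⁆) (ℕₚ.≤-reflexive (cong₂ _+_ (∣⁅x⁆∣≡1 c) (∣⁅x⁆∣≡1 d))))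

  -- A repeated control would leave a singleton, and the gate would be weighed as a CNOT.
  ∣⁅c⁆∪⁅d⁆∣>1 : ∀ {c d : Fin m} → c ≢ d → 1 < ∣ ⁅ c ⁆ ∪ ⁅ d ⁆ ∣
  ∣⁅c⁆∪⁅d⁆∣>1 {c = c} {d} c≢d = subst (_< ∣ ⁅ c ⁆ ∪ ⁅ d ⁆ ∣) (∣⁅x⁆∣≡1 c)
    (p⊂q⇒∣p∣<∣q∣ (p⊆p∪q ⁅ d ⁆ , d , q⊆p∪q ⁅ c ⁆ ⁅ d ⁆ (x∈⁅x⁆ d) , x≢y⇒x∉⁅y⁆ (c≢d ∘ sym)))

  -- Counting light and heavy gates

  isLight : Gate m → Bool
  isLight g = ∣ controls g ∣ ≤ᵇ 1

  tally : (Gate m → Bool) → Circuit m → ℕ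
  tally P = sum ∘ List.map (λ g → if P g then 1 else 0)

  -- The two kinds are bounded separately because the ratio of their weights is arbitrary. Upper
  -- bounds instead of exact counts leave room for rounding.
  record Cost (𝔖 : Circuit m) (c t : ℕ) : Set where
    constructor cost
    field
      light-≤ : tally isLight 𝔖 ≤ c
      heavy-≤ : tally (not ∘ isLight) 𝔖 ≤ t

  open Cost public

  tally-++ : ∀ P (𝔖 𝔗 : Circuit m) → tally P (𝔖 ++ 𝔗) ≡ tally P 𝔖 + tally P 𝔗
  tally-++ P 𝔖 𝔗 = trans (cong sum (Listₚ.map-++ _ 𝔖 𝔗)) (sum-++ (List.map _ 𝔖) _)

  Cost-[] : Cost {m} [] 0 0
  Cost-[] = cost z≤n z≤n

  Cost-++ : ∀ {𝔖 𝔗 : Circuit m} {c t c′ t′} → Cost 𝔖 c t → Cost 𝔗 c′ t′ → Cost (𝔖 ++ 𝔗) (c + c′) (t + t′)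
  Cost-++ {𝔖 = 𝔖} {𝔗} (cost p q) (cost p′ q′) = cost
    (ℕₚ.≤-trans (ℕₚ.≤-reflexive (tally-++ isLight 𝔖 𝔗)) (ℕₚ.+-mono-≤ p p′))
    (ℕₚ.≤-trans (ℕₚ.≤-reflexive (tally-++ (not ∘ isLight) 𝔖 𝔗)) (ℕₚ.+-mono-≤ q q′))

  Cost-≤ : ∀ {𝔖 : Circuit m} {c t c′ t′} → c ≤ c′ → t ≤ t′ → Cost 𝔖 c t → Cost 𝔖 c′ t′
  Cost-≤ c≤ t≤ (cost p q) = cost (ℕₚ.≤-trans p c≤) (ℕₚ.≤-trans q t≤)

  Cost-concatMap : ∀ {A : Set} {block : A → Circuit m} {c t} → (∀ a → Cost (block a) c t) →
    ∀ as → Cost (concatMap block as) (length as * c) (length as * t)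
  Cost-concatMap h []       = Cost-[]
  Cost-concatMap h (a ∷ as) = Cost-++ (h a) (Cost-concatMap h as)

  Cost-light : ∀ {g : Gate m} → ∣ controls g ∣ ≤ 1 → Cost (g ∷ []) 1 0
  Cost-light {g = g} h = cost
    (ℕₚ.≤-reflexive (cong (λ b → (if b then 1 else 0) + 0) light))
    (ℕₚ.≤-reflexive (cong (λ b → (if not b then 1 else 0) + 0) light))
    where
    light : isLight g ≡ true
    light = Equivalence.to T-≡ (ℕₚ.≤⇒≤ᵇ h)

  Cost-heavy : ∀ {g : Gate m} → 1 < ∣ controls g ∣ → Cost (g ∷ []) 0 1
  Cost-heavy {g = g} h = cost
    (ℕₚ.≤-reflexive (cong (λ b → (if b then 1 else 0) + 0) heavy))
    (ℕₚ.≤-reflexive (cong (λ b → (if not b then 1 else 0) + 0) heavy))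
    where
    heavy : isLight g ≡ false
    heavy = ¬-not λ light → ℕₚ.<⇒≱ h (ℕₚ.≤ᵇ⇒≤ ∣ controls g ∣ 1 (Equivalence.from T-≡ light))

  Cost-NOT : ∀ (t : Fin m) → Cost (NOT t ∷ []) 1 0
  Cost-NOT {m} t = Cost-light {g = NOT t} (ℕₚ.≤-trans (ℕₚ.≤-reflexive (∣⊥∣≡0 m)) z≤n)

  Cost-CNOT : ∀ (c t : Fin m) c≢t → Cost (CNOT c t c≢t ∷ []) 1 0
  Cost-CNOT c t c≢t = Cost-light {g = CNOT c t c≢t} (ℕₚ.≤-reflexive (∣⁅x⁆∣≡1 c))

  Cost-C²NOT : ∀ (c d t : Fin m) c≢t d≢t → c ≢ d → Cost (C²NOT c d t c≢t d≢t ∷ []) 0 1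
  Cost-C²NOT c d t c≢t d≢t c≢d = Cost-heavy {g = C²NOT c d t c≢t d≢t} (∣⁅c⁆∪⁅d⁆∣>1 c≢d)

  -- Effect and frame of a circuit

  apply-target : ∀ (g : Gate m) x → lookup (applyGate x g) (target g) ≡ lookup x (target g) xor ⋀ (controls g) x
  apply-target g x = Vecₚ.lookup∘updateAt (target g) x

  apply-other : ∀ (g : Gate m) {ℓ} → target g ≢ ℓ → ∀ x → lookup (applyGate x g) ℓ ≡ lookup x ℓ
  apply-other g {ℓ} t≢ℓ x = Vecₚ.lookup∘updateAt′ ℓ (target g) (t≢ℓ ∘ sym) x

  run-++ : ∀ (𝔖 𝔗 : Circuit m) x → run (𝔖 ++ 𝔗) x ≡ run 𝔗 (run 𝔖 x)
  run-++ 𝔖 𝔗 x = Listₚ.foldl-++ applyGate x 𝔖 𝔗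

  Targets : (Fin m → Set) → Circuit m → Set
  Targets Z = All (Z ∘ target)

  -- A gate writes nothing but its target, so non-interference of circuits reduces to inequality of
  -- lines.
  run-frame : ∀ {Z : Fin m → Set} {𝔖} → Targets Z 𝔖 → ∀ {ℓ} → ¬ Z ℓ → ∀ x → lookup (run 𝔖 x) ℓ ≡ lookup x ℓ
  run-frame []                     ¬Z x = refl
  run-frame {Z = Z} {g ∷ 𝔖} (z ∷ zs) ¬Z x =
    trans (run-frame zs ¬Z (applyGate x g)) (apply-other g (λ eq → ¬Z (subst Z eq z)) x)

  Targets-concatMap : ∀ {A : Set} {Z : Fin m → Set} {block : A → Circuit m} →
    (∀ a → Targets Z (block a)) → ∀ as → Targets Z (concatMap block as)
  Targets-concatMap h as = Allₚ.concat⁺ (Allₚ.map⁺ (All.universal h as))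

  module _ {A : Set} (block : A → Circuit m) (Ready Done : A → Vec Bool m → Set)
    (effect : ∀ a x → Ready a x → Done a (run (block a) x))
    (Ready-stable : ∀ a b → a ≢ b → ∀ x → Ready a x → Ready a (run (block b) x))
    (Done-stable : ∀ a b → a ≢ b → ∀ x → Done a x → Done a (run (block b) x))
    where
    private
      Done-stable* : ∀ {a} bs → All (a ≢_) bs → ∀ x → Done a x → Done a (run (concatMap block bs) x)
      Done-stable* []       _          x d = d
      Done-stable* {a} (b ∷ bs) (a≢b ∷ a≢) x d = subst (Done a) (sym (run-++ (block b) _ x))
        (Done-stable* bs a≢ _ (Done-stable a b a≢b x d))

    -- Blocks run in sequence but act as if independent: what a block needs survives the earlier
    -- ones, what it achieves survives the later ones. `Unique` keeps a block from running again
    -- over its own result, a case on which the stability hypotheses are silent. Table entries, XOR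
    -- tables and output rows are all handled this way.
    parallel : ∀ as → Unique as → ∀ x → (∀ {a} → a ∈ as → Ready a x) →
      ∀ {a} → a ∈ as → Done a (run (concatMap block as) x)
    parallel (a ∷ as) (a≢ ∷ _) x ready (here refl) = subst (Done a) (sym (run-++ (block a) _ x))
      (Done-stable* as a≢ _ (effect a x (ready (here refl))))
    parallel (b ∷ as) (b≢ ∷ u) x ready {a} (there a∈as) = subst (Done a) (sym (run-++ (block b) _ x))
      (parallel as u (run (block b) x)
        (λ {c} c∈as → Ready-stable c b (All.lookup b≢ c∈as ∘ sym) x (ready (there c∈as))) a∈as)

  -- Tables of AND and XOR combinations

  allVecs : ∀ s → List (Vec Bool s)
  allVecs zero    = [] ∷ []
  allVecs (suc s) = List.map (false ∷_) (allVecs s) ++ List.map (true ∷_) (allVecs s)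

  length-allVecs : ∀ s → length (allVecs s) ≡ 2 ^ s
  length-allVecs zero    = refl
  length-allVecs (suc s) = begin
    length (List.map (false ∷_) (allVecs s) ++ List.map (true ∷_) (allVecs s))
      ≡⟨ Listₚ.length-++ (List.map (false ∷_) (allVecs s)) ⟩
    length (List.map (false ∷_) (allVecs s)) + length (List.map (true ∷_) (allVecs s))
      ≡⟨ cong₂ _+_ (Listₚ.length-map _ (allVecs s)) (Listₚ.length-map _ (allVecs s)) ⟩
    length (allVecs s) + length (allVecs s)
      ≡⟨ cong₂ _+_ (length-allVecs s) (trans (length-allVecs s) (sym (ℕₚ.+-identityʳ _))) ⟩
    2 ^ suc s ∎
    where open ≡-Reasoning

  ∈-allVecs : (u : Vec Bool s) → u ∈ allVecs s
  ∈-allVecs []          = here refl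
  ∈-allVecs (false ∷ u) = ∈-++⁺ˡ (∈-map⁺ (false ∷_) (∈-allVecs u))
  ∈-allVecs {suc s} (true ∷ u) = ∈-++⁺ʳ (List.map (false ∷_) (allVecs s)) (∈-map⁺ (true ∷_) (∈-allVecs u))

  false∷≢true∷ : ∀ {u v : Vec Bool s} → false ∷ u ≢ true ∷ v
  false∷≢true∷ ()

  allVecs-unique : ∀ s → Unique (allVecs s)
  allVecs-unique zero    = [] ∷ []
  allVecs-unique (suc s) = Uniqueₚ.++⁺
    (Uniqueₚ.map⁺ Vecₚ.∷-injectiveʳ (allVecs-unique s))
    (Uniqueₚ.map⁺ Vecₚ.∷-injectiveʳ (allVecs-unique s))
    λ (p , q) → let (_ , _ , eq) = ∈-map⁻ (false ∷_) p ; (_ , _ , eq′) = ∈-map⁻ (true ∷_) q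
                in false∷≢true∷ (trans (sym eq) eq′)

  -- With `_xor_` this is the scalar product over the two-element field, with `_∧_` the monomial
  -- with exponent vector `u`; one table construction thus serves both.
  collect : (Bool → Bool → Bool) → Bool → Vec Bool s → Vec Bool s → Bool
  collect op e []          []       = e
  collect op e (false ∷ u) (y ∷ ys) = collect op e u ys
  collect op e (true ∷ u)  (y ∷ ys) = op y (collect op e u ys)

  record Gadget (m : ℕ) : Set where
    field
      op           : Bool → Bool → Bool
      unit         : Bool
      init         : Fin m → Circuit m
      step         : (b o t : Fin m) → b ≢ t → o ≢ t → Circuit m
      init-targets : ∀ t → Targets (t ≡_) (init t)
      init-value   : ∀ t x → lookup x t ≡ false → lookup (run (init t) x) t ≡ unit
      step-targets : ∀ b o t b≢t o≢t → Targets (t ≡_) (step b o t b≢t o≢t)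
      step-value   : ∀ b o t b≢t o≢t x → lookup x t ≡ false →
                     lookup (run (step b o t b≢t o≢t) x) t ≡ op (lookup x b) (lookup x o)
      initᶜ stepᶜ stepᵀ : ℕ
      init-cost    : ∀ t → Cost (init t) initᶜ 0
      step-cost    : ∀ b o t b≢t o≢t → b ≢ o → Cost (step b o t b≢t o≢t) stepᶜ stepᵀ

  module Table (𝔾 : Gadget m) where
    open Gadget 𝔾

    -- Several indices of `basis` may share a line, as can happen in a padded chunk.
    record Layout (s : ℕ) : Set where
      field
        line           : Vec Bool s → Fin m
        basis          : Fin s → Fin m
        line-injective : ∀ {u v} → line u ≡ line v → u ≡ v
        basis≢line     : ∀ i u → basis i ≢ line u
    open Layout

    tail : Layout (suc s) → Layout s
    tail L = record
      { line           = line L ∘ (false ∷_)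
      ; basis          = basis L ∘ suc
      ; line-injective = Vecₚ.∷-injectiveʳ ∘ line-injective L
      ; basis≢line     = λ i u → basis≢line L (suc i) (false ∷ u)
      }

    block : (L : Layout (suc s)) → Vec Bool s → Circuit m
    block L u = step (basis L zero) (line L (false ∷ u)) (line L (true ∷ u))
      (basis≢line L zero (true ∷ u)) (λ eq → false∷≢true∷ (line-injective L eq))

    -- Doubling: the entry for `true ∷ u` is a single step away from the entry for `false ∷ u`,
    -- which is already in place.
    table : Layout s → Circuit m
    table {zero}  L = init (line L [])
    table {suc s} L = table (tail L) ++ concatMap (block L) (allVecs s)

    block-targets : ∀ (L : Layout (suc s)) u → Targets (line L (true ∷ u) ≡_) (block L u)
    block-targets L u = step-targets _ _ _ _ _

    table-targets : (L : Layout s) → Targets (λ ℓ → ∃[ u ] line L u ≡ ℓ) (table L)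
    table-targets {zero}  L = All.map ([] ,_) (init-targets (line L []))
    table-targets {suc s} L = Allₚ.++⁺
      (All.map (λ (u , eq) → false ∷ u , eq) (table-targets (tail L)))
      (Targets-concatMap (λ u → All.map (true ∷ u ,_) (block-targets L u)) (allVecs s))

    table-frame : (L : Layout s) → ∀ {ℓ} → (∀ u → line L u ≢ ℓ) → ∀ x → lookup (run (table L) x) ℓ ≡ lookup x ℓ
    table-frame L ≢ℓ = run-frame (table-targets L) (λ (u , eq) → ≢ℓ u eq)

    table-correct : (L : Layout s) → ∀ x → (∀ u → lookup x (line L u) ≡ false) →
      ∀ u → lookup (run (table L) x) (line L u) ≡ collect op unit u (Vec.tabulate (lookup x ∘ basis L))
    table-correct {zero} L x clean [] = init-value (line L []) x (clean [])
    table-correct {suc s} L x clean w = trans (cong (λ y → lookup y (line L w)) (run-++ (table (tail L)) _ x)) (go w)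
      where
      y = run (table (tail L)) x
      z = run (concatMap (block L) (allVecs s)) y
      b = basis L zero
      old = λ u → collect op unit u (Vec.tabulate (lookup x ∘ basis L ∘ suc))
      -- Blocks read lines `false ∷ u` and the first basis line but write only lines `true ∷ u`, so
      -- none spoils the source of another.
      Ready Done : Vec Bool s → Vec Bool m → Set
      Ready u σ = lookup σ (line L (true ∷ u)) ≡ false ×
                  lookup σ (line L (false ∷ u)) ≡ old u × lookup σ b ≡ lookup x b
      Done u σ = lookup σ (line L (true ∷ u)) ≡ op (lookup x b) (old u)
      stable : ∀ v {ℓ} → line L (true ∷ v) ≢ ℓ → ∀ σ → lookup (run (block L v) σ) ℓ ≡ lookup σ ℓ
      stable v = run-frame (block-targets L v)
      distinct : ∀ {u v} → u ≢ v → line L (true ∷ v) ≢ line L (true ∷ u)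
      distinct u≢v eq = u≢v (sym (Vecₚ.∷-injectiveʳ (line-injective L eq)))
      result : ∀ u → Done u z
      result u = parallel (block L) Ready Done
        (λ u σ (p , q , r) → trans (step-value _ _ _ _ _ σ p) (cong₂ op r q))
        (λ u v u≢v σ (p , q , r) →
          trans (stable v (distinct u≢v) σ) p ,
          trans (stable v (λ eq → false∷≢true∷ (sym (line-injective L eq))) σ) q ,
          trans (stable v (λ eq → basis≢line L zero (true ∷ v) (sym eq)) σ) r)
        (λ u v u≢v σ d → trans (stable v (distinct u≢v) σ) d)
        (allVecs s) (allVecs-unique s) y
        (λ {u} _ →
          trans (table-frame (tail L) (λ v eq → false∷≢true∷ (line-injective L eq)) x) (clean (true ∷ u)) ,
          table-correct (tail L) x (clean ∘ (false ∷_)) u ,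
          table-frame (tail L) (λ v eq → basis≢line L zero (false ∷ v) (sym eq)) x)
        (∈-allVecs u)
      go : ∀ w → lookup z (line L w) ≡ collect op unit w (Vec.tabulate (lookup x ∘ basis L))
      go (false ∷ u) = trans
        (run-frame (Targets-concatMap {Z = λ ℓ → ∃[ v ] line L (true ∷ v) ≡ ℓ}
          (λ v → All.map (v ,_) (block-targets L v)) (allVecs s))
          (λ (v , eq) → false∷≢true∷ (sym (line-injective L eq))) y)
        (table-correct (tail L) x (clean ∘ (false ∷_)) u)
      go (true ∷ u) = result u

    -- A table takes 2^s - 1 steps; counting 2^s instead makes the recursion an exact doubling.
    table-cost : (L : Layout s) → Cost (table L) (initᶜ + 2 ^ s * stepᶜ) (2 ^ s * stepᵀ)
    table-cost {zero}  L = Cost-≤ (ℕₚ.m≤m+n initᶜ _) z≤n (init-cost (line L []))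
    table-cost {suc s} L = Cost-≤
      (ℕₚ.≤-reflexive (trans (cong (λ x → initᶜ + 2 ^ s * stepᶜ + x * stepᶜ) (length-allVecs s))
        (solve 3 (λ i a c → i :+ a :* c :+ a :* c := i :+ (con 2 :* a) :* c) refl initᶜ (2 ^ s) stepᶜ)))
      (ℕₚ.≤-reflexive (trans (cong (λ x → 2 ^ s * stepᵀ + x * stepᵀ) (length-allVecs s))
        (solve 2 (λ a c → a :* c :+ a :* c := (con 2 :* a) :* c) refl (2 ^ s) stepᵀ)))
      (Cost-++ (table-cost (tail L))
        (Cost-concatMap (λ u → step-cost _ _ _ _ _ (basis≢line L zero (false ∷ u))) (allVecs s)))
      where open +-*-Solver

  NOT-value : ∀ (t : Fin m) x → lookup (applyGate x (NOT t)) t ≡ lookup x t xor true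
  NOT-value t x = trans (apply-target (NOT t) x) (cong (lookup x t xor_) (⋀-⊥ x))

  CNOT-value : ∀ (c t : Fin m) c≢t x → lookup (applyGate x (CNOT c t c≢t)) t ≡ lookup x t xor lookup x c
  CNOT-value c t c≢t x = trans (apply-target (CNOT c t c≢t) x) (cong (lookup x t xor_) (⋀-⁅⁆ c x))

  C²NOT-value : ∀ (c d t : Fin m) c≢t d≢t x →
    lookup (applyGate x (C²NOT c d t c≢t d≢t)) t ≡ lookup x t xor (lookup x c ∧ lookup x d)
  C²NOT-value c d t c≢t d≢t x = trans (apply-target (C²NOT c d t c≢t d≢t) x)
    (cong (lookup x t xor_) (trans (⋀-∪ ⁅ c ⁆ ⁅ d ⁆ x) (cong₂ _∧_ (⋀-⁅⁆ c x) (⋀-⁅⁆ d x))))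

  ∧-gadget : Gadget m
  ∧-gadget = record
    { op           = _∧_
    ; unit         = true
    ; init         = λ t → NOT t ∷ []
    ; step         = λ b o t b≢t o≢t → C²NOT b o t b≢t o≢t ∷ []
    ; init-targets = λ t → refl ∷ []
    ; init-value   = λ t x h → trans (NOT-value t x) (cong (_xor true) h)
    ; step-targets = λ b o t b≢t o≢t → refl ∷ []
    ; step-value   = λ b o t b≢t o≢t x h → trans (C²NOT-value b o t b≢t o≢t x) (cong (_xor (lookup x b ∧ lookup x o)) h)
    ; initᶜ        = 1
    ; stepᶜ        = 0
    ; stepᵀ        = 1
    ; init-cost    = Cost-NOT
    ; step-cost    = Cost-C²NOT
    }

  xor-gadget : Gadget m
  xor-gadget = record
    { op           = _xor_
    ; unit         = false
    ; init         = λ t → []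
    ; step         = λ b o t b≢t o≢t → CNOT o t o≢t ∷ CNOT b t b≢t ∷ []
    ; init-targets = λ t → []
    ; init-value   = λ t x h → h
    ; step-targets = λ b o t b≢t o≢t → refl ∷ refl ∷ []
    ; step-value   = λ b o t b≢t o≢t x h →
        let y = applyGate x (CNOT o t o≢t) in
        trans (CNOT-value b t b≢t y)
          (trans (cong₂ _xor_ (trans (CNOT-value o t o≢t x) (cong (_xor lookup x o) h))
                              (apply-other (CNOT o t o≢t) (b≢t ∘ sym) x))
                 (xor-comm (lookup x o) (lookup x b)))
    ; initᶜ        = 0
    ; stepᶜ        = 2
    ; stepᵀ        = 0
    ; init-cost    = λ t → Cost-[]
    ; step-cost    = λ b o t b≢t o≢t _ → Cost-++ (Cost-CNOT o t o≢t) (Cost-CNOT b t b≢t)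
    }

  -- Scalar products over the two-element field, cut into chunks

  dot monomial : Vec Bool s → Vec Bool s → Bool
  dot      = collect _xor_ false
  monomial = collect _∧_ true

  dots : Vec (Vec Bool s) p → Vec (Vec Bool s) p → Bool
  dots []       []       = false
  dots (a ∷ as) (e ∷ es) = dot a e xor dots as es

  xor-swap : ∀ a b c → a xor (b xor c) ≡ b xor (a xor c)
  xor-swap a b c = trans (sym (xor-assoc a b c)) (trans (cong (_xor c) (xor-comm a b)) (xor-assoc b a c))

  xor-cancelˡ : ∀ a b → a xor (a xor b) ≡ b
  xor-cancelˡ a b = trans (sym (xor-assoc a a b)) (cong (_xor b) (xor-same a))

  xor-interchange : ∀ a b c d → (a xor b) xor (c xor d) ≡ (a xor c) xor (b xor d)
  xor-interchange a b c d = trans (xor-assoc a b (c xor d)) (trans (cong (a xor_) (xor-swap b c d)) (sym (xor-assoc a c (b xor d))))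

  dot-xor : ∀ (a b e : Vec Bool s) → dot (Vec.zipWith _xor_ a b) e ≡ dot a e xor dot b e
  dot-xor []          []          []      = refl
  dot-xor (false ∷ a) (false ∷ b) (y ∷ e) = dot-xor a b e
  dot-xor (false ∷ a) (true ∷ b)  (y ∷ e) = trans (cong (y xor_) (dot-xor a b e)) (xor-swap y (dot a e) (dot b e))
  dot-xor (true ∷ a)  (false ∷ b) (y ∷ e) = trans (cong (y xor_) (dot-xor a b e)) (sym (xor-assoc y (dot a e) (dot b e)))
  dot-xor (true ∷ a)  (true ∷ b)  (y ∷ e) = begin
    dot (Vec.zipWith _xor_ a b) e             ≡⟨ dot-xor a b e ⟩
    dot a e xor dot b e                       ≡⟨ cong (_xor (dot a e xor dot b e)) (xor-same y) ⟨
    (y xor y) xor (dot a e xor dot b e)       ≡⟨ xor-interchange y y (dot a e) (dot b e) ⟩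
    (y xor dot a e) xor (y xor dot b e)       ∎
    where open ≡-Reasoning

  -- Linearity in the coefficients lets an accumulator pass from one coefficient vector to the next
  -- by adding their difference.
  dots-xor : ∀ (a b e : Vec (Vec Bool s) p) → dots (Vec.zipWith (Vec.zipWith _xor_) a b) e ≡ dots a e xor dots b e
  dots-xor []       []       []       = refl
  dots-xor (a ∷ as) (b ∷ bs) (e ∷ es) =
    trans (cong₂ _xor_ (dot-xor a b e) (dots-xor as bs es)) (xor-interchange (dot a e) (dot b e) (dots as es) (dots bs es))

  dot-replicate-false : (e : Vec Bool s) → dot (Vec.replicate s false) e ≡ false
  dot-replicate-false []      = refl
  dot-replicate-false (y ∷ e) = dot-replicate-false e

  dots-replicate-false : (e : Vec (Vec Bool s) p) → dots (Vec.replicate p (Vec.replicate s false)) e ≡ false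
  dots-replicate-false []       = refl
  dots-replicate-false (e ∷ es) = cong₂ _xor_ (dot-replicate-false e) (dots-replicate-false es)

  dot-++ : ∀ (a : Vec Bool k) (b : Vec Bool l) e f → dot (a Vec.++ b) (e Vec.++ f) ≡ dot a e xor dot b f
  dot-++ []          b []      f = refl
  dot-++ (false ∷ a) b (y ∷ e) f = dot-++ a b e f
  dot-++ (true ∷ a)  b (y ∷ e) f = trans (cong (y xor_) (dot-++ a b e f)) (sym (xor-assoc y (dot a e) (dot b f)))

  dot-concat : ∀ (as es : Vec (Vec Bool s) p) → dot (Vec.concat as) (Vec.concat es) ≡ dots as es
  dot-concat []       []       = refl
  dot-concat (a ∷ as) (e ∷ es) = trans (dot-++ a (Vec.concat as) e (Vec.concat es)) (cong (dot a e xor_) (dot-concat as es))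

  chunk : ∀ {A : Set} {N} → N ≤ p * s → A → Vec A N → Vec (Vec A s) p
  chunk {p} {s} N≤ps d xs = proj₁ (Vec.group p s (Vec.padRight N≤ps d xs))

  concat-chunk : ∀ {A : Set} {N} (N≤ps : N ≤ p * s) d (xs : Vec A N) →
    Vec.concat (chunk {p} {s} N≤ps d xs) ≡ Vec.padRight N≤ps d xs
  concat-chunk {p} {s} N≤ps d xs = sym (proj₂ (Vec.group p s (Vec.padRight N≤ps d xs)))

  -- The padding carries the coefficient `false`, so the value `μ d` never enters the sum.
  dot-padRight : ∀ {A : Set} {N P} (h : N ≤ P) (μ : A → Bool) d c (xs : Vec A N) →
    dot (Vec.padRight h false c) (Vec.map μ (Vec.padRight h d xs)) ≡ dot c (Vec.map μ xs)
  dot-padRight {P = P} z≤n μ d [] [] = dot-replicate-false (Vec.map μ (Vec.replicate P d))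
  dot-padRight (s≤s h) μ d (false ∷ c) (x ∷ xs) = dot-padRight h μ d c xs
  dot-padRight (s≤s h) μ d (true ∷ c)  (x ∷ xs) = cong (μ x xor_) (dot-padRight h μ d c xs)

  dots-chunk : ∀ {A : Set} {N} (h : N ≤ p * s) (μ : A → Bool) d c (xs : Vec A N) →
    dots (chunk {p} {s} h false c) (Vec.map (Vec.map μ) (chunk h d xs)) ≡ dot c (Vec.map μ xs)
  dots-chunk {p} {s} {A} h μ d c xs = begin
    dots as (Vec.map (Vec.map μ) yss)                        ≡⟨ dot-concat as (Vec.map (Vec.map μ) yss) ⟨
    dot (Vec.concat as) (Vec.concat (Vec.map (Vec.map μ) yss)) ≡⟨ cong (dot (Vec.concat as)) (Vecₚ.map-concat μ yss) ⟨
    dot (Vec.concat as) (Vec.map μ (Vec.concat yss))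
      ≡⟨ cong₂ (λ a b → dot a (Vec.map μ b)) (concat-chunk {p} h false c) (concat-chunk {p} h d xs) ⟩
    dot (Vec.padRight h false c) (Vec.map μ (Vec.padRight h d xs)) ≡⟨ dot-padRight h μ d c xs ⟩
    dot c (Vec.map μ xs) ∎
    where
    open ≡-Reasoning
    as : Vec (Vec Bool s) p
    as = chunk h false c
    yss : Vec (Vec A s) p
    yss = chunk h d xs

  -- XOR sums and the algebraic normal form

  ⨁ : {A : Set} → (A → Bool) → List A → Bool
  ⨁ f = List.foldr (λ a r → f a xor r) false

  ⨁-cong : ∀ {A : Set} {f g : A → Bool} → (∀ a → f a ≡ g a) → ∀ as → ⨁ f as ≡ ⨁ g as
  ⨁-cong f≗g []       = refl
  ⨁-cong f≗g (a ∷ as) = cong₂ _xor_ (f≗g a) (⨁-cong f≗g as)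

  ⨁-++ : ∀ {A : Set} (f : A → Bool) as bs → ⨁ f (as ++ bs) ≡ ⨁ f as xor ⨁ f bs
  ⨁-++ f []       bs = refl
  ⨁-++ f (a ∷ as) bs = trans (cong (f a xor_) (⨁-++ f as bs)) (sym (xor-assoc (f a) (⨁ f as) (⨁ f bs)))

  ⨁-map : ∀ {A B : Set} (f : B → Bool) (g : A → B) as → ⨁ f (List.map g as) ≡ ⨁ (f ∘ g) as
  ⨁-map f g []       = refl
  ⨁-map f g (a ∷ as) = cong (f (g a) xor_) (⨁-map f g as)

  ⨁-false : ∀ {A : Set} (as : List A) → ⨁ (λ a → false) as ≡ false
  ⨁-false []       = refl
  ⨁-false (a ∷ as) = ⨁-false as

  dot-fromList : ∀ {A : Set} (f μ : A → Bool) as →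
    dot (Vec.map f (Vec.fromList as)) (Vec.map μ (Vec.fromList as)) ≡ ⨁ (λ a → f a ∧ μ a) as
  dot-fromList f μ []       = refl
  dot-fromList f μ (a ∷ as) with f a
  ... | true  = cong (μ a xor_) (dot-fromList f μ as)
  ... | false = dot-fromList f μ as

  -- The coefficients of the algebraic normal form (Zhegalkin polynomial) of h.
  anf : (Vec Bool s → Bool) → Vec Bool s → Bool
  anf h []          = h []
  anf h (false ∷ u) = anf (h ∘ (false ∷_)) u
  anf h (true ∷ u)  = anf (λ y → h (false ∷ y) xor h (true ∷ y)) u

  -- Induction along h(b, y) = h(0, y) + b (h(0, y) + h(1, y)) over the two-element field. The two
  -- halves of `allVecs`, without and with the first variable, contribute the two terms.
  anf-correct : ∀ (h : Vec Bool s → Bool) y → h y ≡ ⨁ (λ u → anf h u ∧ monomial u y) (allVecs s)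
  anf-correct h [] = sym (trans (xor-identityʳ _) (∧-identityʳ (h [])))
  anf-correct {suc s} h (b ∷ y) = sym (begin
    ⨁ G (List.map (false ∷_) (allVecs s) ++ List.map (true ∷_) (allVecs s))
      ≡⟨ ⨁-++ G (List.map (false ∷_) (allVecs s)) _ ⟩
    ⨁ G (List.map (false ∷_) (allVecs s)) xor ⨁ G (List.map (true ∷_) (allVecs s))
      ≡⟨ cong₂ _xor_ (⨁-map G (false ∷_) (allVecs s)) (⨁-map G (true ∷_) (allVecs s)) ⟩
    ⨁ (G ∘ (false ∷_)) (allVecs s) xor ⨁ (G ∘ (true ∷_)) (allVecs s)
      ≡⟨ cong (_xor ⨁ (G ∘ (true ∷_)) (allVecs s)) (anf-correct (h ∘ (false ∷_)) y) ⟨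
    h (false ∷ y) xor ⨁ (G ∘ (true ∷_)) (allVecs s)
      ≡⟨ second b ⟩
    h (b ∷ y) ∎)
    where
    open ≡-Reasoning
    Δ = λ y → h (false ∷ y) xor h (true ∷ y)
    G = λ u → anf h u ∧ monomial u (b ∷ y)
    second : ∀ b → h (false ∷ y) xor ⨁ (λ u → anf Δ u ∧ (b ∧ monomial u y)) (allVecs s) ≡ h (b ∷ y)
    second true  = trans (cong (h (false ∷ y) xor_) (sym (anf-correct Δ y))) (xor-cancelˡ (h (false ∷ y)) (h (true ∷ y)))
    second false = trans
      (cong (h (false ∷ y) xor_) (trans (⨁-cong (λ u → ∧-zeroʳ (anf Δ u)) (allVecs s)) (⨁-false (allVecs s))))
      (xor-identityʳ (h (false ∷ y)))

  -- Accumulators and output rows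

  module _ (acc : Fin m) where
    load : (combo : Fin p → Vec Bool s → Fin m) → (∀ j u → combo j u ≢ acc) → Vec (Vec Bool s) p → Circuit m
    load combo combo≢acc []       = []
    load combo combo≢acc (a ∷ as) = CNOT (combo zero a) acc (combo≢acc zero a) ∷ load (combo ∘ suc) (combo≢acc ∘ suc) as

    load-targets : ∀ (combo : Fin p → Vec Bool s → Fin m) combo≢acc as → Targets (acc ≡_) (load combo combo≢acc as)
    load-targets combo combo≢acc []       = []
    load-targets combo combo≢acc (a ∷ as) = refl ∷ load-targets (combo ∘ suc) (combo≢acc ∘ suc) as

    load-correct : ∀ (combo : Fin p → Vec Bool s → Fin m) combo≢acc as es x →
      (∀ j u → lookup x (combo j u) ≡ dot u (lookup es j)) →
      lookup (run (load combo combo≢acc as) x) acc ≡ lookup x acc xor dots as es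
    load-correct combo combo≢acc []       []       x h = sym (xor-identityʳ (lookup x acc))
    load-correct combo combo≢acc (a ∷ as) (e ∷ es) x h = begin
      lookup (run (load (combo ∘ suc) (combo≢acc ∘ suc) as) y) acc
        ≡⟨ load-correct (combo ∘ suc) (combo≢acc ∘ suc) as es y
             (λ j u → trans (apply-other g (λ eq → combo≢acc (suc j) u (sym eq)) x) (h (suc j) u)) ⟩
      lookup y acc xor dots as es
        ≡⟨ cong (_xor dots as es) (trans (CNOT-value (combo zero a) acc (combo≢acc zero a) x)
           (cong (lookup x acc xor_) (h zero a))) ⟩
      (lookup x acc xor dot a e) xor dots as es
        ≡⟨ xor-assoc (lookup x acc) (dot a e) (dots as es) ⟩
      lookup x acc xor (dot a e xor dots as es) ∎
      where
      open ≡-Reasoning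
      g = CNOT (combo zero a) acc (combo≢acc zero a)
      y = applyGate x g

    load-cost : ∀ (combo : Fin p → Vec Bool s → Fin m) combo≢acc as → Cost (load combo combo≢acc as) p 0
    load-cost combo combo≢acc []       = Cost-[]
    load-cost combo combo≢acc (a ∷ as) = Cost-++ (Cost-CNOT (combo zero a) acc (combo≢acc zero a))
      (load-cost (combo ∘ suc) (combo≢acc ∘ suc) as)

    module Row (combo : Fin p → Vec Bool s → Fin m) (mono : Vec Bool l → Fin m) (out : Fin m)
      (combo≢acc : ∀ j u → combo j u ≢ acc) (combo≢out : ∀ j u → combo j u ≢ out)
      (mono≢acc : ∀ u → mono u ≢ acc) (mono≢out : ∀ u → mono u ≢ out) (acc≢out : acc ≢ out)
      (A : Vec Bool l → Vec (Vec Bool s) p) where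

      term : Vec Bool l → Gate m
      term u = C²NOT acc (mono u) out acc≢out (mono≢out u)

      -- Between two terms the accumulator is updated by the difference of the
      -- coefficient vectors, so it never has to be cleared.
      row : Vec (Vec Bool s) p → List (Vec Bool l) → Circuit m
      row a []       = []
      row a (u ∷ us) = load combo combo≢acc (Vec.zipWith (Vec.zipWith _xor_) a (A u)) ++ (term u ∷ row (A u) us)

      row-targets : ∀ a us → Targets (λ ℓ → acc ≡ ℓ ⊎ out ≡ ℓ) (row a us)
      row-targets a []       = []
      row-targets a (u ∷ us) = Allₚ.++⁺ (All.map inj₁ (load-targets combo combo≢acc _)) (inj₂ refl ∷ row-targets (A u) us)

      -- Generality in `a` carries the invariant that the accumulator holds the sum for the
      -- coefficient vector loaded last. That sum is still there when the row ends, which is why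
      -- each coordinate has an accumulator of its own.
      row-correct : ∀ es (M : Vec Bool l → Bool) a us x →
        (∀ j u → lookup x (combo j u) ≡ dot u (lookup es j)) → (∀ u → lookup x (mono u) ≡ M u) →
        lookup x acc ≡ dots a es →
        lookup (run (row a us) x) out ≡ lookup x out xor ⨁ (λ u → dots (A u) es ∧ M u) us
      row-correct es M a []       x hc hm ha = sym (xor-identityʳ (lookup x out))
      row-correct es M a (u ∷ us) x hc hm ha = begin
        lookup (run (row a (u ∷ us)) x) out
          ≡⟨ cong (λ z → lookup z out) (run-++ ld (term u ∷ row (A u) us) x) ⟩
        lookup (run (row (A u) us) z) out
          ≡⟨ row-correct es M (A u) us z (λ j v → trans (same (combo≢acc j v) (combo≢out j v)) (hc j v))
               (λ v → trans (same (mono≢acc v) (mono≢out v)) (hm v)) (trans (apply-other (term u) (acc≢out ∘ sym) y) y-acc) ⟩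
        lookup z out xor rest
          ≡⟨ cong (_xor rest) (C²NOT-value acc (mono u) out acc≢out (mono≢out u) y) ⟩
        (lookup y out xor (lookup y acc ∧ lookup y (mono u))) xor rest
          ≡⟨ cong (_xor rest) (cong₂ _xor_ (frame acc≢out)
               (cong₂ _∧_ y-acc (trans (frame (mono≢acc u ∘ sym)) (hm u)))) ⟩
        (lookup x out xor (dots (A u) es ∧ M u)) xor rest
          ≡⟨ xor-assoc (lookup x out) _ rest ⟩
        lookup x out xor ((dots (A u) es ∧ M u) xor rest) ∎
        where
        open ≡-Reasoning
        δ  = Vec.zipWith (Vec.zipWith _xor_) a (A u)
        ld = load combo combo≢acc δ
        y = run ld x
        z = applyGate y (term u)
        rest = ⨁ (λ u → dots (A u) es ∧ M u) us
        frame : ∀ {ℓ} → acc ≢ ℓ → lookup y ℓ ≡ lookup x ℓ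
        frame acc≢ℓ = run-frame (load-targets combo combo≢acc δ) acc≢ℓ x
        same : ∀ {ℓ} → ℓ ≢ acc → ℓ ≢ out → lookup z ℓ ≡ lookup x ℓ
        same ℓ≢acc ℓ≢out = trans (apply-other (term u) (ℓ≢out ∘ sym) y) (frame (ℓ≢acc ∘ sym))
        -- The old content plus the difference: `a` cancels and the sum for `A u` remains.
        y-acc : lookup y acc ≡ dots (A u) es
        y-acc = trans (load-correct combo combo≢acc δ es x hc)
          (trans (cong₂ _xor_ ha (dots-xor a (A u) es)) (xor-cancelˡ (dots a es) (dots (A u) es)))

      row-cost : ∀ a us → Cost (row a us) (length us * p) (length us * 1)
      row-cost a []       = Cost-[]
      row-cost a (u ∷ us) = Cost-++ (load-cost combo combo≢acc _)
        (Cost-++ (Cost-C²NOT acc (mono u) out acc≢out (mono≢out u) (mono≢acc u ∘ sym)) (row-cost (A u) us))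

  -- Assignment of lines

  module _ {A B : Set} {a b : ℕ} (f : A → Fin a) (g : B → Fin b) where
    joinMap : A ⊎ B → Fin (a + b)
    joinMap = Fin.join a b ∘ Sum.map f g

    joinMap-injective : (∀ {x y} → f x ≡ f y → x ≡ y) → (∀ {x y} → g x ≡ g y → x ≡ y) →
      ∀ {x y} → joinMap x ≡ joinMap y → x ≡ y
    joinMap-injective f-inj g-inj {x} {y} eq = cancel x y
      (trans (sym (Finₚ.splitAt-join a b (Sum.map f g x)))
        (trans (cong (Fin.splitAt a) eq) (Finₚ.splitAt-join a b (Sum.map f g y))))
      where
      cancel : ∀ x y → Sum.map f g x ≡ Sum.map f g y → x ≡ y
      cancel (inj₁ x) (inj₁ y) eq = cong inj₁ (f-inj (inj₁-injective eq))
      cancel (inj₂ x) (inj₂ y) eq = cong inj₂ (g-inj (inj₂-injective eq))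

  bit : Bool → Fin 2
  bit false = zero
  bit true  = suc zero

  bit-injective : ∀ {a b} → bit a ≡ bit b → a ≡ b
  bit-injective {false} {false} _ = refl
  bit-injective {true}  {true}  _ = refl

  code : Vec Bool s → Fin (2 ^ s)
  code []      = zero
  code (b ∷ u) = Fin.combine (bit b) (code u)

  code-injective : ∀ {u v : Vec Bool s} → code u ≡ code v → u ≡ v
  code-injective {u = []}    {[]}    _  = refl
  code-injective {u = a ∷ u} {b ∷ v} eq =
    let (p , q) = Finₚ.combine-injective (bit a) (code u) (bit b) (code v) eq
    in cong₂ _∷_ (bit-injective p) (code-injective q)

  module _ (k l s p q : ℕ) (fits : ancillas (k + l) k l s p ≤ q) (2^k≤ps : 2 ^ k ≤ p * s) where
    private
      n = k + l

    -- Naming lines by a sum type turns most inequalities of lines into clashes of constructors,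
    -- which an absurd pattern settles.
    Line Ancilla : Set
    Ancilla = Fin n ⊎ (Vec Bool l ⊎ (Vec Bool k ⊎ (Fin p × Vec Bool s)))
    Line    = Fin n ⊎ Ancilla

    pattern input i    = inj₁ i
    pattern acc i      = inj₂ (inj₁ i)
    pattern tailMono u = inj₂ (inj₂ (inj₁ u))
    pattern headMono v = inj₂ (inj₂ (inj₂ (inj₁ v)))
    pattern combo j w  = inj₂ (inj₂ (inj₂ (inj₂ (j , w))))

    ancilla : Ancilla → Fin (ancillas n k l s p)
    ancilla = joinMap id (joinMap code (joinMap code λ (j , w) → Fin.combine j (code w)))

    ancilla-injective : ∀ {a b} → ancilla a ≡ ancilla b → a ≡ b
    ancilla-injective = joinMap-injective _ _ id (joinMap-injective _ _ code-injective (joinMap-injective _ _ code-injective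
      λ {(i , u)} {(j , v)} eq → let (e , e′) = Finₚ.combine-injective i (code u) j (code v) eq
                                 in cong₂ _,_ e (code-injective e′)))

    initial : Vec Bool n → Vec Bool (n + q)
    initial x = x Vec.++ Vec.replicate q false

    -- Sealed, so that lines are compared through `wire-injective` and not by unfolding positions.
    -- Inputs keep their own positions; results written over them already stand first, and the
    -- output permutation is the identity.
    abstract
      wire : Line → Fin (n + q)
      wire = joinMap id (λ a → Fin.inject≤ (ancilla a) fits)

      wire-input : ∀ i → wire (inj₁ i) ≡ i Fin.↑ˡ q
      wire-input i = refl

      wire-injective : ∀ {x y} → wire x ≡ wire y → x ≡ y
      wire-injective = joinMap-injective _ _ id (ancilla-injective ∘ Finₚ.inject≤-injective fits fits _ _)

      initial-input : ∀ x i → lookup (initial x) (wire (input i)) ≡ lookup x i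
      initial-input x i = Vecₚ.lookup-++ˡ x _ i

      initial-ancilla : ∀ x a → lookup (initial x) (wire (inj₂ a)) ≡ false
      initial-ancilla x a = trans (Vecₚ.lookup-++ʳ x _ (Fin.inject≤ (ancilla a) fits))
        (Vecₚ.lookup-replicate (Fin.inject≤ (ancilla a) fits) false)

    wire-≢ : ∀ {x y} → x ≢ y → wire x ≢ wire y
    wire-≢ x≢y = x≢y ∘ wire-injective

    module 𝕋∧ = Table {n + q} ∧-gadget
    module 𝕋⊕ = Table {n + q} xor-gadget

    tailLayout : 𝕋∧.Layout l
    tailLayout = record
      { line           = λ u → wire (tailMono u)
      ; basis          = λ i → wire (input (k Fin.↑ʳ i))
      ; line-injective = λ eq → inj₁-injective (inj₂-injective (inj₂-injective (wire-injective eq)))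
      ; basis≢line     = λ i u → wire-≢ λ ()
      }

    headLayout : 𝕋∧.Layout k
    headLayout = record
      { line           = λ v → wire (headMono v)
      ; basis          = λ i → wire (input (i Fin.↑ˡ l))
      ; line-injective = λ eq → inj₁-injective (inj₂-injective (inj₂-injective (inj₂-injective (wire-injective eq))))
      ; basis≢line     = λ i v → wire-≢ λ ()
      }

    |allVecs|≤ps : length (allVecs k) ≤ p * s
    |allVecs|≤ps = ℕₚ.≤-trans (ℕₚ.≤-reflexive (length-allVecs k)) 2^k≤ps

    -- The last chunk is padded with an arbitrary monomial, whose coefficient will be false.
    monomials : Vec (Vec (Vec Bool k) s) p
    monomials = chunk |allVecs|≤ps (Vec.replicate k false) (Vec.fromList (allVecs k))

    combo-injective : ∀ {j j′ : Fin p} {w w′ : Vec Bool s} → wire (combo j w) ≡ wire (combo j′ w′) → (j , w) ≡ (j′ , w′)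
    combo-injective eq = inj₂-injective (inj₂-injective (inj₂-injective (inj₂-injective (wire-injective eq))))

    comboLayout : Fin p → 𝕋⊕.Layout s
    comboLayout j = record
      { line           = λ w → wire (combo j w)
      ; basis          = λ i → wire (headMono (lookup (lookup monomials j) i))
      ; line-injective = λ eq → cong proj₂ (combo-injective eq)
      ; basis≢line     = λ i w → wire-≢ λ ()
      }

    comboTable : Fin p → Circuit (n + q)
    comboTable j = 𝕋⊕.table (comboLayout j)

    tableStage : Circuit (n + q)
    tableStage = 𝕋∧.table tailLayout ++ (𝕋∧.table headLayout ++ concatMap comboTable (allFin p))

    -- Tabulated because this is the form in which `table-correct` delivers the values of the basis
    -- lines.
    headOf : Vec Bool n → Vec Bool k
    headOf x = Vec.tabulate λ i → lookup x (i Fin.↑ˡ l)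

    tailOf : Vec Bool n → Vec Bool l
    tailOf x = Vec.tabulate λ i → lookup x (k Fin.↑ʳ i)

    headOf++tailOf : ∀ x → headOf x Vec.++ tailOf x ≡ x
    headOf++tailOf x = trans (cong₂ Vec._++_
        (trans (Vecₚ.tabulate-cong (λ i → trans (cong (λ z → lookup z (i Fin.↑ˡ l)) (sym eq)) (Vecₚ.lookup-++ˡ xₕ xₜ i)))
               (Vecₚ.tabulate∘lookup xₕ))
        (trans (Vecₚ.tabulate-cong (λ i → trans (cong (λ z → lookup z (k Fin.↑ʳ i)) (sym eq)) (Vecₚ.lookup-++ʳ xₕ xₜ i)))
               (Vecₚ.tabulate∘lookup xₜ)))
      eq
      where
      xₕ = Vec.take k x
      xₜ = Vec.drop k x
      eq = Vecₚ.take++drop≡id k x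

    chunkValues : Vec Bool n → Vec (Vec Bool s) p
    chunkValues x = Vec.map (Vec.map λ v → monomial v (headOf x)) monomials

    -- The state on which the rows depend. Head monomials are absent since the rows reach them only
    -- through the XOR tables.
    record Prepared (x : Vec Bool n) (σ : Vec Bool (n + q)) : Set where
      field
        input-value : ∀ i → lookup σ (wire (input i)) ≡ lookup x i
        acc-value   : ∀ i → lookup σ (wire (acc i)) ≡ false
        tail-value  : ∀ u → lookup σ (wire (tailMono u)) ≡ monomial u (tailOf x)
        combo-value : ∀ j w → lookup σ (wire (combo j w)) ≡ dot w (lookup (chunkValues x) j)

    tableStage-correct : ∀ x → Prepared x (run tableStage (initial x))
    tableStage-correct x = subst (Prepared x)
      (sym (trans (run-++ 𝔖₁ (𝔖₂ ++ 𝔖₃) σ₀) (run-++ 𝔖₂ 𝔖₃ σ₁)))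
      record
        { input-value = λ i → trans (frame₃ (λ _ _ ()) σ₂) (trans (frame₂ (λ _ ())) (trans (frame₁ (λ _ ())) (initial-input x i)))
        ; acc-value   = λ i → trans (frame₃ (λ _ _ ()) σ₂) (trans (frame₂ (λ _ ())) (trans (frame₁ (λ _ ())) (initial-ancilla x _)))
        ; tail-value  = λ u → trans (frame₃ (λ _ _ ()) σ₂) (trans (frame₂ (λ _ ())) (value₁ u))
        ; combo-value = λ j → value₃ j
        }
      where
      𝔖₁ = 𝕋∧.table tailLayout
      𝔖₂ = 𝕋∧.table headLayout
      𝔖₃ = concatMap comboTable (allFin p)
      σ₀ = initial x
      σ₁ = run 𝔖₁ σ₀
      σ₂ = run 𝔖₂ σ₁

      frame₁ : ∀ {y} → (∀ u → tailMono u ≢ y) → lookup σ₁ (wire y) ≡ lookup σ₀ (wire y)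
      frame₁ h = 𝕋∧.table-frame tailLayout (λ u → wire-≢ (h u)) σ₀

      frame₂ : ∀ {y} → (∀ v → headMono v ≢ y) → lookup σ₂ (wire y) ≡ lookup σ₁ (wire y)
      frame₂ h = 𝕋∧.table-frame headLayout (λ v → wire-≢ (h v)) σ₁

      frame₃ : ∀ {y} → (∀ j w → combo j w ≢ y) → ∀ σ → lookup (run 𝔖₃ σ) (wire y) ≡ lookup σ (wire y)
      frame₃ {y} h = run-frame
        (Targets-concatMap {Z = λ ℓ → ∃[ j ] ∃[ w ] wire (combo j w) ≡ ℓ}
          (λ j → All.map (j ,_) (𝕋⊕.table-targets (comboLayout j))) (allFin p))
        (λ (j , w , eq) → wire-≢ (h j w) eq)

      value₁ : ∀ u → lookup σ₁ (wire (tailMono u)) ≡ monomial u (tailOf x)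
      value₁ u = trans (𝕋∧.table-correct tailLayout σ₀ (λ u → initial-ancilla x _) u)
        (cong (monomial u) (Vecₚ.tabulate-cong λ i → initial-input x _))

      value₂ : ∀ v → lookup σ₂ (wire (headMono v)) ≡ monomial v (headOf x)
      value₂ v = trans (𝕋∧.table-correct headLayout σ₁ (λ v → trans (frame₁ (λ _ ())) (initial-ancilla x _)) v)
        (cong (monomial v) (Vecₚ.tabulate-cong λ i → trans (frame₁ (λ _ ())) (initial-input x _)))

      -- All XOR tables draw on the same head-monomial lines, which none of them overwrites.
      Ready Done : Fin p → Vec Bool (n + q) → Set
      Ready j σ = (∀ w → lookup σ (wire (combo j w)) ≡ false) × (∀ v → lookup σ (wire (headMono v)) ≡ monomial v (headOf x))
      Done j σ = ∀ w → lookup σ (wire (combo j w)) ≡ dot w (lookup (chunkValues x) j)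

      basis-value : ∀ j {σ} → (∀ v → lookup σ (wire (headMono v)) ≡ monomial v (headOf x)) →
        Vec.tabulate (λ i → lookup σ (wire (headMono (lookup (lookup monomials j) i)))) ≡ lookup (chunkValues x) j
      basis-value j h = begin
        Vec.tabulate _                                               ≡⟨ Vecₚ.tabulate-cong (λ i → h _) ⟩
        Vec.tabulate (μ ∘ lookup (lookup monomials j))               ≡⟨ Vecₚ.tabulate-∘ μ (lookup (lookup monomials j)) ⟩
        Vec.map μ (Vec.tabulate (lookup (lookup monomials j)))       ≡⟨ cong (Vec.map μ) (Vecₚ.tabulate∘lookup (lookup monomials j)) ⟩
        Vec.map μ (lookup monomials j)                               ≡⟨ Vecₚ.lookup-map j (Vec.map μ) monomials ⟨
        lookup (chunkValues x) j                                     ∎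
        where
        open ≡-Reasoning
        μ = λ v → monomial v (headOf x)

      stable : ∀ {i j} → i ≢ j → ∀ w σ → lookup (run (comboTable j) σ) (wire (combo i w)) ≡ lookup σ (wire (combo i w))
      stable {i} {j} i≢j w = 𝕋⊕.table-frame (comboLayout j) (λ w′ eq → i≢j (sym (cong proj₁ (combo-injective eq))))

      value₃ : ∀ j → Done j (run 𝔖₃ σ₂)
      value₃ j = parallel comboTable Ready Done
        (λ j σ (clean , head) w → trans (𝕋⊕.table-correct (comboLayout j) σ clean w) (cong (dot w) (basis-value j {σ} head)))
        (λ i j i≢j σ (clean , head) →
          (λ w → trans (stable i≢j w σ) (clean w)) ,
          (λ v → trans (𝕋⊕.table-frame (comboLayout j) (λ _ → wire-≢ λ ()) σ) (head v)))
        (λ i j i≢j σ done w → trans (stable i≢j w σ) (done w))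
        (allFin p) (Uniqueₚ.allFin⁺ p) σ₂
        (λ {j} _ → (λ w → trans (frame₂ (λ _ ())) (trans (frame₁ (λ _ ())) (initial-ancilla x _))) , value₂)
        (∈-allFin j)

    -- The circuit of a given map

    module _ (f : Vec Bool n → Vec Bool n) where
      -- The input lines still hold x when f x is added to them.
      correction : Fin n → Vec Bool n → Bool
      correction i x = lookup x i xor lookup (f x) i

      -- The normal form is taken in the tail variables with the head held fixed, which gives gᵤ for
      -- coordinate `i`. A second normal form, now in the head variables, will make it an XOR of
      -- head monomials.
      coefficient : Fin n → Vec Bool l → Vec Bool k → Bool
      coefficient i u xₕ = anf (λ xₜ → correction i (xₕ Vec.++ xₜ)) u

      coefficients : Fin n → Vec Bool l → Vec (Vec Bool s) p
      coefficients i u = chunk |allVecs|≤ps false (Vec.map (anf (coefficient i u)) (Vec.fromList (allVecs k)))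

      coefficients-correct : ∀ i u x → dots (coefficients i u) (chunkValues x) ≡ coefficient i u (headOf x)
      coefficients-correct i u x = trans
        (dots-chunk {p} {s} |allVecs|≤ps _ _ _ (Vec.fromList (allVecs k)))
        (trans (dot-fromList (anf (coefficient i u)) (λ v → monomial v (headOf x)) (allVecs k))
          (sym (anf-correct (coefficient i u) (headOf x))))

      module RowOf (i : Fin n) = Row (wire (acc i)) (λ j w → wire (combo j w)) (λ u → wire (tailMono u)) (wire (input i))
        (λ j w → wire-≢ λ ()) (λ j w → wire-≢ λ ()) (λ u → wire-≢ λ ()) (λ u → wire-≢ λ ()) (wire-≢ λ ()) (coefficients i)

      rowOf : Fin n → Circuit (n + q)
      rowOf i = RowOf.row i (Vec.replicate p (Vec.replicate s false)) (allVecs l)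

      circuit : Circuit (n + q)
      circuit = tableStage ++ concatMap rowOf (allFin n)

      circuit-correct : ∀ x i → lookup (run circuit (initial x)) (wire (input i)) ≡ lookup (f x) i
      circuit-correct x i = trans (cong (λ σ → lookup σ (wire (input i))) (run-++ tableStage (concatMap rowOf (allFin n)) (initial x)))
        (parallel rowOf Ready Done effect Ready-stable Done-stable (allFin n) (Uniqueₚ.allFin⁺ n) _
          (λ {i} _ → ready i) (∈-allFin i))
        where
        open Prepared
        -- No input line of another coordinate occurs here, so overwriting those lines leaves
        -- `Ready i` intact.
        Ready Done : Fin n → Vec Bool (n + q) → Set
        Ready i σ = (lookup σ (wire (input i)) ≡ lookup x i × lookup σ (wire (acc i)) ≡ false) ×
                    (∀ u → lookup σ (wire (tailMono u)) ≡ monomial u (tailOf x)) ×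
                    (∀ j w → lookup σ (wire (combo j w)) ≡ dot w (lookup (chunkValues x) j))
        Done i σ = lookup σ (wire (input i)) ≡ lookup (f x) i

        ready : ∀ i → Ready i (run tableStage (initial x))
        ready i = let P = tableStage-correct x in (input-value P i , acc-value P i) , tail-value P , combo-value P

        frame : ∀ i {y} → acc i ≢ y → input i ≢ y → ∀ σ → lookup (run (rowOf i) σ) (wire y) ≡ lookup σ (wire y)
        frame i acc≢ input≢ = run-frame (RowOf.row-targets i _ (allVecs l)) [ wire-≢ acc≢ , wire-≢ input≢ ]′

        Ready-stable : ∀ i j → i ≢ j → ∀ σ → Ready i σ → Ready i (run (rowOf j) σ)
        Ready-stable i j i≢j σ ((a , b) , c , d) =
          (trans (frame j (λ ()) (λ eq → i≢j (sym (inj₁-injective eq))) σ) a ,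
           trans (frame j (λ eq → i≢j (sym (inj₁-injective (inj₂-injective eq)))) (λ ()) σ) b) ,
          (λ u → trans (frame j (λ ()) (λ ()) σ) (c u)) ,
          (λ j′ w → trans (frame j (λ ()) (λ ()) σ) (d j′ w))

        Done-stable : ∀ i j → i ≢ j → ∀ σ → Done i σ → Done i (run (rowOf j) σ)
        Done-stable i j i≢j σ d = trans (frame j (λ ()) (λ eq → i≢j (sym (inj₁-injective eq))) σ) d

        effect : ∀ i σ → Ready i σ → Done i (run (rowOf i) σ)
        effect i σ ((a , b) , c , d) = begin
          lookup (run (rowOf i) σ) (wire (input i))
            ≡⟨ RowOf.row-correct i es M _ (allVecs l) σ d c (trans b (sym (dots-replicate-false es))) ⟩
          lookup σ (wire (input i)) xor ⨁ (λ u → dots (coefficients i u) es ∧ M u) (allVecs l)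
            ≡⟨ cong₂ _xor_ a (⨁-cong (λ u → cong (_∧ M u) (coefficients-correct i u x)) (allVecs l)) ⟩
          lookup x i xor ⨁ (λ u → coefficient i u (headOf x) ∧ M u) (allVecs l)
            ≡⟨ cong (lookup x i xor_) (anf-correct (λ xₜ → correction i (headOf x Vec.++ xₜ)) (tailOf x)) ⟨
          lookup x i xor correction i (headOf x Vec.++ tailOf x)
            ≡⟨ cong (λ x′ → lookup x i xor correction i x′) (headOf++tailOf x) ⟩
          lookup x i xor (lookup x i xor lookup (f x) i)
            ≡⟨ xor-cancelˡ (lookup x i) (lookup (f x) i) ⟩
          lookup (f x) i ∎
          where
          open ≡-Reasoning
          es = chunkValues x
          M = λ u → monomial u (tailOf x)

      circuit-implements : Implements q circuit f
      circuit-implements = idₚ , λ x → let y = run circuit (initial x) in Vec.drop n y , (begin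
        Vec.tabulate (lookup y)           ≡⟨ Vecₚ.tabulate∘lookup y ⟩
        y                                 ≡⟨ Vecₚ.take++drop≡id n y ⟨
        Vec.take n y Vec.++ Vec.drop n y  ≡⟨ cong (Vec._++ Vec.drop n y) (outputs x y (circuit-correct x)) ⟩
        f x Vec.++ Vec.drop n y           ∎)
        where
        open ≡-Reasoning
        outputs : ∀ x y → (∀ i → lookup y (wire (input i)) ≡ lookup (f x) i) → Vec.take n y ≡ f x
        outputs x y h = begin
          Vec.take n y                          ≡⟨ Vecₚ.tabulate∘lookup (Vec.take n y) ⟨
          Vec.tabulate (lookup (Vec.take n y))  ≡⟨ Vecₚ.tabulate-cong (λ i → trans (sym (Vecₚ.lookup-++ˡ (Vec.take n y) (Vec.drop n y) i))
                                                     (trans (cong₂ lookup (Vecₚ.take++drop≡id n y) (sym (wire-input i))) (h i))) ⟩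
          Vec.tabulate (lookup (f x))           ≡⟨ Vecₚ.tabulate∘lookup (f x) ⟩
          f x                                   ∎

      circuit-cost : Cost circuit (cnotBound n k l s p) (toffoliBound n k l s p)
      circuit-cost = Cost-≤ (ℕₚ.≤-reflexive cnots) (ℕₚ.≤-reflexive toffolis)
        (Cost-++
          (Cost-++ (𝕋∧.table-cost tailLayout)
          (Cost-++ (𝕋∧.table-cost headLayout)
                   (Cost-concatMap (λ j → 𝕋⊕.table-cost (comboLayout j)) (allFin p))))
          (Cost-concatMap (λ i → RowOf.row-cost i _ (allVecs l)) (allFin n)))
        where
        open +-*-Solver
        cnots : (1 + 2 ^ l * 0 + (1 + 2 ^ k * 0 + length (allFin p) * (2 ^ s * 2)))
              + length (allFin n) * (length (allVecs l) * p)
              ≡ cnotBound n k l s p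
        cnots rewrite Listₚ.length-tabulate {n = p} id | Listₚ.length-tabulate {n = n} id | length-allVecs l =
          solve 6 (λ a b p c n d → (con 1 :+ a :* con 0 :+ (con 1 :+ b :* con 0 :+ p :* (c :* con 2))) :+ n :* d
                                := con 2 :+ (p :* (con 2 :* c) :+ n :* d)) refl (2 ^ l) (2 ^ k) p (2 ^ s) n (2 ^ l * p)
        toffolis : (2 ^ l * 1 + (2 ^ k * 1 + length (allFin p) * (2 ^ s * 0)))
                 + length (allFin n) * (length (allVecs l) * 1)
                 ≡ toffoliBound n k l s p
        toffolis rewrite Listₚ.length-tabulate {n = n} id | length-allVecs l =
          solve 5 (λ a b p c n → (a :* con 1 :+ (b :* con 1 :+ p :* (c :* con 0))) :+ n :* (a :* con 1)
                              := a :+ b :+ n :* a) refl (2 ^ l) (2 ^ k) (length (allFin p)) (2 ^ s) n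

-- Constructive ordered fields and the logarithm

module OrderedField {c ℓ₁ ℓ₂} (ℝ : RealNumbers c ℓ₁ ℓ₂) where
  open RealNumbers ℝ
  open IsStrictPartialOrder isStrictPartialOrder public
    using (<-respˡ-≈; <-respʳ-≈)
    renaming (trans to <-trans; irrefl to <-irrefl; asym to <-asym)
  open CommutativeSemiringSolver commutativeSemiring using (solve; _:=_; _:+_; _:*_; con)
  open SemiringMult semiring using (×1-homo-*)

  <-resp₂ : ∀ {x x′ y y′} → x ≈ x′ → y ≈ y′ → x < y → x′ < y′
  <-resp₂ p q x<y = <-respˡ-≈ p (<-respʳ-≈ q x<y)

  ≤-<-trans : ∀ {x y z} → x ≤ y → y < z → x < z
  ≤-<-trans {x} x≤y y<z with <-cotrans y<z x
  ... | inj₁ y<x = ⊥-elim (x≤y y<x)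
  ... | inj₂ x<z = x<z

  <-≤-trans : ∀ {x y z} → x < y → y ≤ z → x < z
  <-≤-trans {z = z} x<y y≤z with <-cotrans x<y z
  ... | inj₁ x<z = x<z
  ... | inj₂ z<y = ⊥-elim (y≤z z<y)

  <⇒≤ : ∀ {x y} → x < y → x ≤ y
  <⇒≤ = <-asym

  ≤-refl : ∀ {x} → x ≤ x
  ≤-refl = <-irrefl refl

  ≤-trans : ∀ {x y z} → x ≤ y → y ≤ z → x ≤ z
  ≤-trans x≤y y≤z z<x = y≤z (<-≤-trans z<x x≤y)

  ≤-resp₂ : ∀ {x x′ y y′} → x ≈ x′ → y ≈ y′ → x ≤ y → x′ ≤ y′
  ≤-resp₂ p q x≤y y′<x′ = x≤y (<-resp₂ (sym q) (sym p) y′<x′)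

  +-monoˡ-< : ∀ z {x y} → x < y → x + z < y + z
  +-monoˡ-< z x<y = <-resp₂ (+-comm z _) (+-comm z _) (+-monoʳ-< z x<y)

  +-cancelˡ-< : ∀ z {x y} → z + x < z + y → x < y
  +-cancelˡ-< z {x} {y} p = <-resp₂ (lemma x) (lemma y) (+-monoʳ-< (- z) p)
    where
    lemma : ∀ w → - z + (z + w) ≈ w
    lemma w = trans (sym (+-assoc (- z) z w)) (trans (+-congʳ (-‿inverseˡ z)) (+-identityˡ w))

  +-monoʳ-≤ : ∀ z {x y} → x ≤ y → z + x ≤ z + y
  +-monoʳ-≤ z x≤y p = x≤y (+-cancelˡ-< z p)

  +-mono-≤ : ∀ {w x y z} → w ≤ x → y ≤ z → w + y ≤ x + z
  +-mono-≤ {w} {x} {y} {z} w≤x y≤z =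
    ≤-trans (+-monoʳ-≤ w y≤z) (≤-resp₂ (+-comm z w) (+-comm z x) (+-monoʳ-≤ z w≤x))

  x<x+y : ∀ x {y} → 0# < y → x < x + y
  x<x+y x 0<y = <-respˡ-≈ (+-identityʳ x) (+-monoʳ-< x 0<y)

  x<y⇒0<y-x : ∀ {x y} → x < y → 0# < y - x
  x<y⇒0<y-x {x} x<y = <-respˡ-≈ (-‿inverseʳ x) (+-monoˡ-< (- x) x<y)

  y-x+x≈y : ∀ x y → (y - x) + x ≈ y
  y-x+x≈y x y = trans (+-assoc y (- x) x) (trans (+-congˡ (-‿inverseˡ x)) (+-identityʳ y))

  *-monoʳ-< : ∀ {x y z} → 0# < z → x < y → x * z < y * z
  *-monoʳ-< {x} {y} {z} 0<z x<y =
    <-respʳ-≈ eq (x<x+y (x * z) (*-pos (x<y⇒0<y-x x<y) 0<z))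
    where
    eq : x * z + (y - x) * z ≈ y * z
    eq = trans (sym (distribʳ z x (y - x))) (*-congʳ (trans (+-comm x (y - x)) (y-x+x≈y x y)))

  *-monoˡ-< : ∀ {x y z} → 0# < z → x < y → z * x < z * y
  *-monoˡ-< 0<z x<y = <-resp₂ (*-comm _ _) (*-comm _ _) (*-monoʳ-< 0<z x<y)

  ι-homo-* : ∀ m n → ι (m ℕ.* n) ≈ ι m * ι n
  ι-homo-* = ×1-homo-*

  ι-1 : ι 1 ≈ 1#
  ι-1 = +-identityʳ 1#

  0≤ι : ∀ n → 0# ≤ ι n
  0≤ι zero    = ≤-refl
  0≤ι (suc n) = ≤-trans (0≤ι n) (<⇒≤ (<-respʳ-≈ (+-comm (ι n) 1#) (x<x+y (ι n) 0<1)))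

  0<ι : ∀ {n} → 0 ℕ.< n → 0# < ι n
  0<ι {suc n} _ = <-≤-trans 0<1 (≤-resp₂ (+-identityʳ 1#) refl (+-monoʳ-≤ 1# (0≤ι n)))

  ι-mono-≤ : ∀ {m n} → m ℕ.≤ n → ι m ≤ ι n
  ι-mono-≤ {n = n} ℕ.z≤n = 0≤ι n
  ι-mono-≤ (ℕ.s≤s m≤n)    = +-monoʳ-≤ 1# (ι-mono-≤ m≤n)

  ι-mono-< : ∀ {m n} → m ℕ.< n → ι m < ι n
  ι-mono-< {m} m<n =
    <-≤-trans (<-respʳ-≈ (+-comm (ι m) 1#) (x<x+y (ι m) 0<1)) (ι-mono-≤ m<n)

  ι-cancel-≤ : ∀ {m n} → ι m ≤ ι n → m ℕ.≤ n
  ι-cancel-≤ {m} {n} p with m ℕₚ.≤? n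
  ... | yes m≤n = m≤n
  ... | no  m≰n = ⊥-elim (p (ι-mono-< (ℕₚ.≰⇒> m≰n)))

  ι-cancel-< : ∀ {m n} → ι m < ι n → m ℕ.< n
  ι-cancel-< {m} {n} p with n ℕₚ.≤? m
  ... | yes n≤m = ⊥-elim (ι-mono-≤ n≤m p)
  ... | no  n≰m = ℕₚ.≰⇒> n≰m

  -- The sign of `x` cannot be decided by cases; cotransitivity instead peels one summand `x` at a
  -- time off the multiple.
  0<ι*x⇒0<x : ∀ n {x} → 0# < ι n * x → 0# < x
  0<ι*x⇒0<x zero    {x} p = ⊥-elim (<-irrefl (sym (zeroˡ x)) p)
  0<ι*x⇒0<x (suc n) {x} p with <-cotrans p x
  ... | inj₁ 0<x = 0<x
  ... | inj₂ q   = 0<ι*x⇒0<x n (+-cancelˡ-< x (<-resp₂ (sym (+-identityʳ x)) eq q))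
    where
    eq : ι (suc n) * x ≈ x + ι n * x
    eq = trans (distribʳ x 1# (ι n)) (+-congʳ (*-identityˡ x))

  -- A positive δ with x * δ < 1 is needed first: cotransitivity then leaves
  -- only recip x < δ to be excluded.
  recip-pos : ∀ x (0<x : 0# < x) → 0# < recip x 0<x
  recip-pos x 0<x with archimedean x
  ... | N , x<N = pos
    where
    0<N = <-trans 0<x x<N
    δ   = recip (ι N) 0<N
    0<δ : 0# < δ
    0<δ = 0<ι*x⇒0<x N (<-respʳ-≈ (sym (*-recip (ι N) 0<N)) 0<1)
    pos : 0# < recip x 0<x
    pos with <-cotrans 0<δ (recip x 0<x)
    ... | inj₁ 0<r = 0<r
    ... | inj₂ r<δ = ⊥-elim (<-irrefl refl
      (<-trans (<-respˡ-≈ (*-recip x 0<x) (*-monoˡ-< 0<x r<δ))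
               (<-respʳ-≈ (*-recip (ι N) 0<N) (*-monoʳ-< 0<δ x<N))))

  /-*-cancel : ∀ x {y} (0<y : 0# < y) → x / y ⟨ 0<y ⟩ * y ≈ x
  /-*-cancel x {y} 0<y =
    trans (*-assoc x _ y) (trans (*-congˡ (trans (*-comm _ y) (*-recip y 0<y))) (*-identityʳ x))

  *-/-cancel : ∀ x {y} (0<y : 0# < y) → (x * y) / y ⟨ 0<y ⟩ ≈ x
  *-/-cancel x {y} 0<y = trans (*-assoc x y _) (trans (*-congˡ (*-recip y 0<y)) (*-identityʳ x))

  *-cancelʳ-< : ∀ {x y z} → 0# < z → x * z < y * z → x < y
  *-cancelʳ-< {x} {y} {z} 0<z p =
    <-resp₂ (*-/-cancel x 0<z) (*-/-cancel y 0<z) (*-monoʳ-< (recip-pos z 0<z) p)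

  *-monoʳ-≤ : ∀ {x y z} → 0# < z → x ≤ y → x * z ≤ y * z
  *-monoʳ-≤ 0<z x≤y p = x≤y (*-cancelʳ-< 0<z p)

  *-monoˡ-≤ : ∀ {x y z} → 0# < z → x ≤ y → z * x ≤ z * y
  *-monoˡ-≤ 0<z x≤y = ≤-resp₂ (*-comm _ _) (*-comm _ _) (*-monoʳ-≤ 0<z x≤y)

  x<y*z⇒x/z<y : ∀ {x y z} (0<z : 0# < z) → x < y * z → x / z ⟨ 0<z ⟩ < y
  x<y*z⇒x/z<y {y = y} {z} 0<z p =
    <-respʳ-≈ (*-/-cancel y 0<z) (*-monoʳ-< (recip-pos z 0<z) p)

  1<ε*ι : ∀ {ε} (0<ε : 0# < ε) {M} → recip ε 0<ε < ι M → 1# < ε * ι M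
  1<ε*ι 0<ε r<M = <-respˡ-≈ (*-recip _ 0<ε) (*-monoˡ-< 0<ε r<M)

  -- Both counts exceed their targets by a factor of at most (M + 1) / M, and M > 1 / ε makes this
  -- less than 1 + ε.
  weighted-sum-< : ∀ {ε} (0<ε : 0# < ε) {a b} → 0# < a → 0# < b →
    ∀ {M A B C D} → 0 ℕ.< M → recip ε 0<ε < ι M →
    M ℕ.* C ℕ.≤ suc M ℕ.* A → M ℕ.* D ℕ.≤ suc M ℕ.* B →
    0# < a * ι A + b * ι B →
    a * ι C + b * ι D < (1# + ε) * (a * ι A + b * ι B)
  weighted-sum-< {ε} 0<ε {a} {b} 0<a 0<b {M} {A} {B} {C} {D} 0<M r<M MC≤ MD≤ 0<s =
    *-cancelʳ-< (0<ι 0<M) (≤-<-trans below above)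
    where
    s = a * ι A + b * ι B
    scaled : ∀ {x X Y} → 0# < x → M ℕ.* Y ℕ.≤ suc M ℕ.* X → x * (ι M * ι Y) ≤ x * (ι (suc M) * ι X)
    scaled {X = X} {Y} 0<x p = *-monoˡ-≤ 0<x (≤-resp₂ (ι-homo-* M Y) (ι-homo-* (suc M) X) (ι-mono-≤ p))
    below : (a * ι C + b * ι D) * ι M ≤ (1# + ι M) * s
    below = ≤-resp₂
      (solve 5 (λ a b c d m → a :* (m :* c) :+ b :* (m :* d) := (a :* c :+ b :* d) :* m)
         refl a b (ι C) (ι D) (ι M))
      (solve 5 (λ a b c d m → a :* (m :* c) :+ b :* (m :* d) := m :* (a :* c :+ b :* d))
         refl a b (ι A) (ι B) (ι (suc M)))
      (+-mono-≤ (scaled 0<a MC≤) (scaled 0<b MD≤))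
    above : (1# + ι M) * s < ((1# + ε) * s) * ι M
    above = <-respʳ-≈
      (solve 3 (λ e m s → (e :* m :+ m) :* s := ((con 1 :+ e) :* s) :* m) refl ε (ι M) s)
      (*-monoʳ-< 0<s (+-monoˡ-< (ι M) (1<ε*ι 0<ε {M} r<M)))

  -- A ratio within 1/2 of 1 exceeds 1/2. The conclusion is an inequality in ℕ, where the order is
  -- decidable, so it suffices to refute its negation.
  half-< : (0<2 : 0# < ι 2) → ∀ {q b} (0<b : 0# < ι b) →
    Within (recip (ι 2) 0<2) (ι q / ι b ⟨ 0<b ⟩) 1# → b ℕ.≤ 2 ℕ.* q
  half-< 0<2 {q} {b} 0<b (_ , 1-r<h) = ℕₚ.≮⇒≥ λ 2q<b →
    let h   = recip (ι 2) 0<2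
        r   = ι q / ι b ⟨ 0<b ⟩
        q<  : ι q < h * ι b
        q<  = *-cancelʳ-< 0<2 (<-resp₂ (trans (ι-homo-* 2 q) (*-comm _ _))
                (sym (trans (trans (*-congʳ (*-comm _ _)) (*-assoc _ h _))
                            (trans (*-congˡ (trans (*-comm h _) (*-recip _ 0<2))) (*-identityʳ _))))
                (ι-mono-< 2q<b))
        r<h : r < h
        r<h = x<y*z⇒x/z<y 0<b q<
        1<  : 1# < h + r
        1<  = <-respˡ-≈ (y-x+x≈y r 1#) (+-monoˡ-< r 1-r<h)
        2h  : h + h ≈ 1#
        2h  = trans (sym (trans (distribʳ h 1# (ι 1))
                (+-cong (*-identityˡ h) (trans (*-congʳ ι-1) (*-identityˡ h))))) (*-recip _ 0<2)
    in <-irrefl refl (<-trans 1< (<-respʳ-≈ 2h (+-monoʳ-< h r<h)))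

  -- The ceiling lies below n / φ + 1, so (k - 1) φ < n; the summand `K` on the right makes up for
  -- the 1.
  ceiling-quotient : ∀ {n k K φ} (0<φ : 0# < φ) → 0 ℕ.< K → ι K < φ →
    IsCeiling (ι n / φ ⟨ 0<φ ⟩) k → k ℕ.* K ℕ.≤ n ℕ.+ K
  ceiling-quotient {k = zero} _ _ _ _ = ℕ.z≤n
  ceiling-quotient {n} {suc j} {K} {φ} 0<φ 0<K K<φ (_ , k<) =
    ℕₚ.≤-trans (ℕₚ.+-monoʳ-≤ K (ι-cancel-≤ (≤-trans (iK≤iφ j) (<⇒≤ jφ<n)))) (ℕₚ.≤-reflexive (ℕₚ.+-comm K n))
    where
    jφ<n : ι j * φ < ι n
    jφ<n = <-respʳ-≈ (/-*-cancel (ι n) 0<φ)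
      (*-monoʳ-< 0<φ (+-cancelˡ-< 1# (<-respʳ-≈ (+-comm _ 1#) k<)))
    iK≤iφ : ∀ i → ι (i ℕ.* K) ≤ ι i * φ
    iK≤iφ zero    = ≤-resp₂ refl (sym (zeroˡ φ)) ≤-refl
    iK≤iφ (suc i) = ≤-resp₂ (sym (ι-homo-* (suc i) K)) refl
      (*-monoˡ-≤ (0<ι {suc i} (ℕ.s≤s ℕ.z≤n)) (<⇒≤ K<φ))

  module _ {log₂ : ∀ x → 0# < x → Carrier} (isLog₂ : Logarithm.IsLog₂ ℝ log₂) where
    open Logarithm.IsLog₂ isLog₂

    log₂-1 : ∀ 0<x → log₂ (ι 1) 0<x ≈ 0#
    log₂-1 0<x = +-cancel (trans (sym (log₂-* 0<x 0<x 0<xx)) (log₂-cong 0<xx 0<x xx≈x))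
      where
      xx≈x = trans (*-congʳ ι-1) (*-identityˡ (ι 1))
      0<xx = <-respʳ-≈ (sym xx≈x) 0<x
      +-cancel : ∀ {y} → y + y ≈ y → y ≈ 0#
      +-cancel {y} p = trans (sym (+-identityʳ y))
        (trans (+-congˡ (sym (-‿inverseʳ y)))
        (trans (sym (+-assoc y y (- y))) (trans (+-congʳ p) (-‿inverseʳ y))))

    log₂-2^ : ∀ k 0<x → log₂ (ι (2 ℕ.^ k)) 0<x ≈ ι k
    log₂-2^ zero    0<x = log₂-1 0<x
    log₂-2^ (suc k) 0<x = trans (log₂-cong 0<x 0<y (ι-homo-* 2 (2 ℕ.^ k)))
      (trans (log₂-* 0<2 0<2^k 0<y) (+-cong (log₂-2 0<2) (log₂-2^ k 0<2^k)))
      where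
      0<2   = 0<ι {2} (ℕ.s≤s ℕ.z≤n)
      0<2^k = 0<ι (ℕₚ.m^n>0 2 k)
      0<y   = *-pos 0<2 0<2^k

    -- The denominator `d` is log₂ (n ψ), and φ d ≤ n gives d ≤ n / φ ≤ k. If 2^k < n K held, then
    -- 2^k < n ψ, and strict monotonicity of the logarithm would give k < d.
    n*K≤2^k : ∀ {n k K φ ψ} (0<n : 0# < ι n) (0<ψ : 0# < ψ) (0<φ : 0# < φ) →
      (0<d : 0# < log₂ (ι n) 0<n + log₂ ψ 0<ψ) →
      φ ≤ ι n / (log₂ (ι n) 0<n + log₂ ψ 0<ψ) ⟨ 0<d ⟩ →
      ι n / φ ⟨ 0<φ ⟩ ≤ ι k → ι K < ψ → n ℕ.* K ℕ.≤ 2 ℕ.^ k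
    n*K≤2^k {n} {k} {K} {φ} {ψ} 0<n 0<ψ 0<φ 0<d φ≤ n/φ≤k K<ψ = ℕₚ.≮⇒≥ λ 2^k<nK →
      let 0<2^k = 0<ι (ℕₚ.m^n>0 2 k)
          0<nψ  = *-pos 0<n 0<ψ
          2^k<nψ = <-trans (<-respʳ-≈ (ι-homo-* n K) (ι-mono-< 2^k<nK)) (*-monoˡ-< 0<n K<ψ)
      in d≤k (<-resp₂ (log₂-2^ k 0<2^k) (log₂-* 0<n 0<ψ 0<nψ) (log₂-mono-< 0<2^k 0<nψ 2^k<nψ))
      where
      d = log₂ (ι n) 0<n + log₂ ψ 0<ψ
      φd≤n : φ * d ≤ ι n
      φd≤n = ≤-resp₂ refl (/-*-cancel (ι n) 0<d) (*-monoʳ-≤ 0<d φ≤)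
      d≤k : d ≤ ι k
      d≤k = ≤-trans
        (≤-resp₂ (trans (*-congʳ (*-comm φ d)) (*-/-cancel d 0<φ)) refl (*-monoʳ-≤ (recip-pos φ 0<φ) φd≤n))
        n/φ≤k

open Arithmetic
open Synthesis

-- The circuit for an admissible k

CheapCircuit : ∀ M n l q → (Vec Bool n → Vec Bool n) → Set
CheapCircuit M n l q f = ∃[ 𝔖 ] Implements q 𝔖 f ×
  M *ℕ tally isLight 𝔖 ≤ℕ suc M *ℕ 2 ^ n ×
  M *ℕ tally (not ∘ isLight) 𝔖 ≤ℕ suc M *ℕ (n *ℕ 2 ^ l)

cheapCircuit : ∀ M {n k q} → 10 ≤ℕ n → 2 *ℕ M ≤ℕ n → 4 *ℕ k ≤ℕ n →
  (4 *ℕ M +ℕ 2) *ℕ k ≤ℕ n → n *ℕ (4 *ℕ M +ℕ 2) ≤ℕ 2 ^ k → n *ℕ 2 ^ (n ∸ k) ≤ℕ 2 *ℕ q →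
  ∀ f → CheapCircuit M n (n ∸ k) q f
cheapCircuit M {n} {k} {q} 10≤n 2M≤n 4k≤n Kk≤n nK≤2^k n2^l≤2q f =
  go n≡ 10≤n 2M≤n Kk≤n nK≤2^k n2^l≤2q f
  where
  open ℕₚ.≤-Reasoning
  K = 4 *ℕ M +ℕ 2
  s = n ∸ (k +ℕ k)

  -- Otherwise 2 n ≤ 4 k ≤ n, impossible for positive n. Hence `s` is positive and can serve as a
  -- chunk length.
  2k<n : k +ℕ k <ℕ n
  2k<n = ℕₚ.≰⇒> λ n≤2k → ℕₚ.<⇒≱ (ℕₚ.m<m+n n (ℕₚ.<-≤-trans (s≤s z≤n) 10≤n)) (begin
    n +ℕ n                     ≤⟨ ℕₚ.+-mono-≤ n≤2k n≤2k ⟩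
    (k +ℕ k) +ℕ (k +ℕ k)       ≡⟨ solve 1 (λ k → (k :+ k) :+ (k :+ k) := con 4 :* k) ≡.refl k ⟩
    4 *ℕ k                     ≤⟨ 4k≤n ⟩
    n                          ∎)
    where open +-*-Solver

  instance
    s≢0 : NonZero s
    s≢0 = >-nonZero (ℕₚ.m<n⇒0<n∸m 2k<n)

  n≡ : n ≡ k +ℕ (k +ℕ s)
  n≡ = ≡.trans (≡.sym (ℕₚ.m+[n∸m]≡n (ℕₚ.<⇒≤ 2k<n))) (ℕₚ.+-assoc k k s)

  -- `s` is a difference formed from `n`; with both generalised, the equation can be matched with
  -- `≡.refl`.
  go : ∀ {n s} .{{_ : NonZero s}} → n ≡ k +ℕ (k +ℕ s) → 10 ≤ℕ n → 2 *ℕ M ≤ℕ n →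
    K *ℕ k ≤ℕ n → n *ℕ K ≤ℕ 2 ^ k → n *ℕ 2 ^ (n ∸ k) ≤ℕ 2 *ℕ q →
    ∀ f → CheapCircuit M n (n ∸ k) q f
  go {s = s} ≡.refl 10≤n 2M≤n Kk≤n nK≤2^k n2^l≤2q f rewrite ℕₚ.m+n∸m≡n k (k +ℕ s) =
    circuit k (k +ℕ s) s p q fits 2^k≤ps f ,
    circuit-implements k (k +ℕ s) s p q fits 2^k≤ps f ,
    ℕₚ.≤-trans (ℕₚ.*-monoʳ-≤ M (light-≤ costs))
      (cnotBound-asymptotic {k} {s} M (ℕₚ.≤-trans (ℕₚ.m≤m+n 3 7) 10≤n) Kk≤n nK≤2^k) ,
    ℕₚ.≤-trans (ℕₚ.*-monoʳ-≤ M (heavy-≤ costs)) (toffoliBound-asymptotic {k} {s} M 2M≤n)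
    where
    p = chunks (2 ^ k) s
    n≤2^k : k +ℕ (k +ℕ s) ≤ℕ 2 ^ k
    n≤2^k = ℕₚ.≤-trans (ℕₚ.m≤m*n _ K {{>-nonZero (ℕₚ.≤-trans (s≤s z≤n) (ℕₚ.m≤n+m 2 (4 *ℕ M)))}}) nK≤2^k
    fits = ancillas-fit {k} {s} 10≤n n≤2^k n2^l≤2q
    2^k≤ps = chunks-lower (2 ^ k) s
    costs = circuit-cost k (k +ℕ s) s p q fits 2^k≤ps f

-- Passage to the limit

Eventually-× : ∀ {a b} {P : ℕ → Set a} {Q : ℕ → Set b} → Eventually P → Eventually Q → Eventually λ n → P n × Q n
Eventually-× (M , p) (N , q) = M +ℕ N , λ n M+N≤n →
  p n (ℕₚ.≤-trans (ℕₚ.m≤m+n M N) M+N≤n) , q n (ℕₚ.≤-trans (ℕₚ.m≤n+m N M) M+N≤n)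

Eventually-map : ∀ {a b} {P : ℕ → Set a} {Q : ℕ → Set b} → (∀ n → P n → Q n) → Eventually P → Eventually Q
Eventually-map f (N , p) = N , λ n N≤n → f n (p n N≤n)

Eventually-≥ : ∀ N → Eventually (N ≤ℕ_)
Eventually-≥ N = N , λ n N≤n → N≤n

module _ {c ℓ₁ ℓ₂} (ℝ : RealNumbers c ℓ₁ ℓ₂) where
  open RealNumbers ℝ
  open QuantumWeight ℝ

  weight-tally : ∀ a b {m} (𝔖 : Circuit m) → weight a b 𝔖 ≈ a * ι (tally isLight 𝔖) + b * ι (tally (not ∘ isLight) 𝔖)
  weight-tally a b []       = sym (trans (+-cong (zeroʳ a) (zeroʳ b)) (+-identityˡ 0#))
  weight-tally a b (g ∷ 𝔖) = trans (+-congˡ (weight-tally a b 𝔖)) (step (isLight g))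
    where
    open CommutativeSemiringSolver commutativeSemiring using (solve; _:=_; _:+_; _:*_; con)
    x = ι (tally isLight 𝔖)
    y = ι (tally (not ∘ isLight) 𝔖)
    step : ∀ light → (if light then a else b) + (a * x + b * y) ≈
      a * ι ((if light then 1 else 0) +ℕ tally isLight 𝔖) + b * ι ((if not light then 1 else 0) +ℕ tally (not ∘ isLight) 𝔖)
    step true  = solve 4 (λ a b x y → a :+ (a :* x :+ b :* y) := a :* (con 1 :+ x) :+ b :* y) refl a b x y
    step false = solve 4 (λ a b x y → b :+ (a :* x :+ b :* y) := a :* x :+ b :* (con 1 :+ y)) refl a b x y

theorem4p7 : ∀ {c ℓ₁ ℓ₂} (ℝ : RealNumbers c ℓ₁ ℓ₂) →
  let open RealNumbers ℝ
      open Logarithm ℝ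
      open Asymptotics ℝ
      open QuantumWeight ℝ
  in
  (log₂ : ∀ x → 0# < x → Carrier) → IsLog₂ log₂ →
  (Wᶜ Wᵀ : Carrier) → 0# < Wᶜ → 0# < Wᵀ →
  (W : ℕ → ℕ → Carrier) → (∀ n q → IsMaxMinWeight Wᶜ Wᵀ n q (W n q)) →
  (φ ψ : ℕ → Carrier) → Growing φ → Growing ψ →
  (Eventually λ n →
    Σ[ 0<n ∈ 0# < ι n ] Σ[ 0<ψn ∈ 0# < ψ n ]
    Σ[ 0<d ∈ 0# < log₂ (ι n) 0<n + log₂ (ψ n) 0<ψn ]
    φ n ≤ ι n / (log₂ (ι n) 0<n + log₂ (ψ n) 0<ψn) ⟨ 0<d ⟩) →
  -- k n = ⌈ n / φ n ⌉ as soon as φ n is positive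
  (k : ℕ → ℕ) →
  (Eventually λ n → Σ[ 0<φn ∈ 0# < φ n ] IsCeiling (ι n / φ n ⟨ 0<φn ⟩) (k n)) →
  (q₀ : ℕ → ℕ) →
  (λ n → ι (q₀ n)) ∼ (λ n → ι (n *ℕ 2 ^ (n ∸ k n))) →
  (λ n → W n (q₀ n)) ≲ (λ n → Wᶜ * ι (2 ^ n) + Wᵀ * ι (n *ℕ 2 ^ (n ∸ k n)))
theorem4p7 ℝ log₂ isLog₂ Wᶜ Wᵀ 0<Wᶜ 0<Wᵀ W W-max φ ψ φ-growing ψ-growing φ≤ k k-ceiling q₀ q₀∼ ε 0<ε =
  Eventually-map bound
    -- The 10 serves the ancilla count. The ceiling may cost a further `2 *ℕ K`, which n absorbs at
    -- the price of a factor 2; this is why φ has to exceed `2 *ℕ K` for `Kk≤n`. Of the asymptotics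
    -- of q₀ only closeness within 1/2 is taken.
    (Eventually-× (Eventually-≥ (10 +ℕ 2 *ℕ K))
    (Eventually-× (φ-growing (ι (2 *ℕ K)))
    (Eventually-× (ψ-growing (ι K))
    (Eventually-× φ≤ (Eventually-× k-ceiling (q₀∼ (recip (ι 2) 0<2) (recip-pos (ι 2) 0<2)))))))
  where
  open RealNumbers ℝ
  open OrderedField ℝ
  open QuantumWeight ℝ
  open +-*-Solver using (solve; _:=_; _:+_; _:*_; con)
  0<2 = 0<ι {2} (s≤s z≤n)
  -- M > 1 / ε, so that (M + 1) / M < 1 + ε.
  M = proj₁ (archimedean (recip ε 0<ε))
  1/ε<M = proj₂ (archimedean (recip ε 0<ε))
  0<M : 0 <ℕ M
  0<M = ι-cancel-< (<-trans (recip-pos ε 0<ε) 1/ε<M)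
  K = 4 *ℕ M +ℕ 2
  4≤K : 4 ≤ℕ K
  4≤K = ℕₚ.≤-trans (ℕₚ.*-monoʳ-≤ 4 0<M) (ℕₚ.m≤m+n (4 *ℕ M) 2)

  bound : ∀ n → _ → Σ[ 0<bn ∈ 0# < Wᶜ * ι (2 ^ n) + Wᵀ * ι (n *ℕ 2 ^ (n ∸ k n)) ]
    W n (q₀ n) / (Wᶜ * ι (2 ^ n) + Wᵀ * ι (n *ℕ 2 ^ (n ∸ k n))) ⟨ 0<bn ⟩ < 1# + ε
  bound n (N≤n , 2K<φ , K<ψ , (0<n , 0<ψ , 0<d , φ≤n) , (0<φ , ceil) , (0<b , near)) =
    0<bn , x<y*z⇒x/z<y 0<bn (≤-<-trans (proj₂ (proj₂ (proj₂ (proj₁ (W-max n (q₀ n))))) 𝔖 𝔖-implements) 𝔖-weight)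
    where
    open ℕₚ.≤-Reasoning
    -- A map that attains the maximum: `W n (q₀ n)` is its minimal weight, hence at most the weight
    -- of `𝔖`.
    f = proj₁ (proj₁ (W-max n (q₀ n)))
    10≤n : 10 ≤ℕ n
    10≤n = ℕₚ.≤-trans (ℕₚ.m≤m+n 10 _) N≤n
    2K≤n : 2 *ℕ K ≤ℕ n
    2K≤n = ℕₚ.≤-trans (ℕₚ.m≤n+m _ 10) N≤n
    2M≤n : 2 *ℕ M ≤ℕ n
    2M≤n = ℕₚ.≤-trans (ℕₚ.*-monoʳ-≤ 2 (ℕₚ.≤-trans (ℕₚ.m≤n*m M 4) (ℕₚ.m≤m+n _ 2))) 2K≤n
    Kk≤n : K *ℕ k n ≤ℕ n
    Kk≤n = ℕₚ.*-cancelˡ-≤ 2 (begin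
      2 *ℕ (K *ℕ k n)    ≡⟨ solve 2 (λ K k → con 2 :* (K :* k) := k :* (con 2 :* K)) ≡.refl K (k n) ⟩
      k n *ℕ (2 *ℕ K)    ≤⟨ ceiling-quotient {n} {k n} {2 *ℕ K} 0<φ
                            (ℕₚ.<-≤-trans (s≤s z≤n) (ℕₚ.*-monoʳ-≤ 2 4≤K)) 2K<φ ceil ⟩
      n +ℕ 2 *ℕ K        ≤⟨ ℕₚ.+-monoʳ-≤ n 2K≤n ⟩
      n +ℕ n             ≡⟨ solve 1 (λ n → n :+ n := con 2 :* n) ≡.refl n ⟩
      2 *ℕ n             ∎)
    cheap = cheapCircuit M {n} {k n} {q₀ n} 10≤n 2M≤n (ℕₚ.≤-trans (ℕₚ.*-monoˡ-≤ (k n) 4≤K) Kk≤n) Kk≤n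
      (n*K≤2^k isLog₂ {n} {k n} {K} 0<n 0<ψ 0<φ 0<d φ≤n (proj₁ ceil) K<ψ)
      (half-< 0<2 {q₀ n} {n *ℕ 2 ^ (n ∸ k n)} 0<b near) f
    𝔖 = proj₁ cheap
    𝔖-implements = proj₁ (proj₂ cheap)
    0<bn : 0# < Wᶜ * ι (2 ^ n) + Wᵀ * ι (n *ℕ 2 ^ (n ∸ k n))
    0<bn = <-trans (*-pos 0<Wᶜ (0<ι (ℕₚ.m^n>0 2 n))) (x<x+y _ (*-pos 0<Wᵀ 0<b))
    𝔖-weight : weight Wᶜ Wᵀ 𝔖 < (1# + ε) * (Wᶜ * ι (2 ^ n) + Wᵀ * ι (n *ℕ 2 ^ (n ∸ k n)))
    𝔖-weight = <-respˡ-≈ (sym (weight-tally ℝ Wᶜ Wᵀ 𝔖))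
      (weighted-sum-< 0<ε 0<Wᶜ 0<Wᵀ {M} {2 ^ n} {n *ℕ 2 ^ (n ∸ k n)} 0<M 1/ε<M
        (proj₁ (proj₂ (proj₂ cheap))) (proj₂ (proj₂ (proj₂ cheap))) 0<bn)
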